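{- The following inequalities hold: (1) $\mathrm{add}(\mathcal{M})\leq\mathrm{add}^*_t(\mathcal{E})\leq\mathfrak{b}$; (2) $\mathfrak{d}\leq\mathrm{cof}^*_t(\mathcal{E})\leq\mathrm{cof}(\mathcal{M})$.
   Context: $2^\omega$ is the Cantor space with coordinatewise addition modulo 2; $\mathcal{M}$ is the $\sigma$-ideal of meager subsets of $2^\omega$ and $\mathcal{E}$ is the $\sigma$-ideal on $2^\omega$ generated by closed Lebesgue measure zero sets. For a $\sigma$-ideal $\mathcal{I}$ on $2^\omega$: $\mathrm{add}(\mathcal{I})=\min\{|\mathcal{F}|:\mathcal{F}\subseteq\mathcal{I},\ \bigcup\mathcal{F}\notin\mathcal{I}\}$; $\mathrm{cof}(\mathcal{I})=\min\{|\mathcal{F}|:\mathcal{F}\subseteq\mathcal{I},\ \forall Y\in\mathcal{I}\ \exists Y'\in\mathcal{F}\ Y\subseteq Y'\}$; $\mathrm{add}^*_t(\mathcal{I})=\min\{|\mathcal{F}|:\mathcal{F}\subseteq\mathcal{I}\text{ and }\neg\exists X\in\mathcal{I}\ \forall F\in\mathcal{F}\ \exists x\in2^\omega\ F+x\subseteq X\}$; $\mathrm{cof}^*_t(\mathcal{I})=\min\{|\mathcal{F}|:\mathcal{F}\subseteq\mathcal{I}\text{ and }\forall Y\in\mathcal{I}\ \exists Y'\in\mathcal{F}\ \exists x\in2^\omega\ Y\subseteq Y'+x\}$. $\mathfrak{b}$ and $\mathfrak{d}$ are the bounding and dominating numbers of $(\omega^\omega,\leq^*)$. -}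

module Defs where

open import Algebra.Definitions.RawMonoid using (sum)
open import Algebra.Definitions.RawSemiring using (_^_)
open import Axiom.ExcludedMiddle using (ExcludedMiddle)
open import Data.Bool.Base using (Bool; _xor_)
open import Data.Fin.Base using (toℕ)
open import Data.Nat.Base as ℕ using (ℕ)
open import Data.Product.Base using (Σ; Σ-syntax; _×_; _,_; proj₁; uncurry)
open import Data.Rational.Base as ℚ using (ℚ; 0ℚ; ½; +-0-rawMonoid; +-*-rawSemiring)
open import Function.Bundles using (Bijection; Injection; _⇔_)
open import Level using (Level; 0ℓ; _⊔_; Setω) renaming (suc to lsuc)
open import Relation.Binary.Bundles using (Setoid)
import Relation.Binary.Construct.On as On
open import Relation.Binary.PropositionalEquality using (_≡_; _≗_; setoid; _→-setoid_)
open import Relation.Nullary.Negation.Core using (¬_)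
open import Relation.Unary using (Pred; _∈_; _∉_; _⊆_; _≐_; _≬_; ∅; ∁; ⋃; Empty)
open import Relation.Unary.Relation.Binary.Equality using (≐-setoid)

-- The ambient logic of the theory of cardinal invariants.  As `Dec P` is data,
-- and is available here for every type P, this also provides choice functions.

Classical : Setω
Classical = ∀ {ℓ : Level} → ExcludedMiddle ℓ

module _ {a ℓ : Level} (S : Setoid a ℓ) where

  open Setoid S using (Carrier)

  Family : Set (a ⊔ lsuc 0ℓ)
  Family = Pred Carrier 0ℓ

  -- The members of 𝓕, identified when they are equal in S.

  members : Family → Setoid a ℓ
  members 𝓕 = On.setoid S (proj₁ {B = 𝓕})

  -- κ = min { |𝓕| : P 𝓕 }.  Cardinals are represented by arbitrary types κ
  -- and compared by injections, so that κ is unique up to equinumerosity.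

  record IsMinCard {p : Level} (P : Pred Family p) (κ : Set) : Set (a ⊔ ℓ ⊔ lsuc 0ℓ ⊔ p) where
    field
      attained : Σ[ 𝓕 ∈ Family ] P 𝓕 × Bijection (setoid κ) (members 𝓕)
      least    : (𝓖 : Family) → P 𝓖 → Injection (setoid κ) (members 𝓖)

2^ω : Set
2^ω = ℕ → Bool

Subset : Set₁
Subset = Pred 2^ω 0ℓ

infixl 6 _⊕_ _+ₜ_

_⊕_ : 2^ω → 2^ω → 2^ω
(x ⊕ y) n = x n xor y n

_+ₜ_ : Subset → 2^ω → Subset
(A +ₜ x) z = Σ[ y ∈ 2^ω ] y ∈ A × z ≗ y ⊕ x

-- The basic clopen set of all points that agree with x below n.

[_↾_] : 2^ω → ℕ → Subset
[ x ↾ n ] y = (i : ℕ) → i ℕ.< n → y i ≡ x i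

Interior : Subset → Subset
Interior A x = Σ[ n ∈ ℕ ] [ x ↾ n ] ⊆ A

Closure : Subset → Subset
Closure A x = (n : ℕ) → [ x ↾ n ] ≬ A

Open : Pred Subset 0ℓ
Open A = A ⊆ Interior A

Closed : Pred Subset 0ℓ
Closed A = Open (∁ A)

NowhereDense : Pred Subset 0ℓ
NowhereDense A = Empty (Interior (Closure A))

-- The measure of the basic clopen set [ x ↾ n ] is 2⁻ⁿ.

measure : 2^ω × ℕ → ℚ
measure (_ , n) = _^_ +-*-rawSemiring ½ n

-- Outer measure zero.  Bounding all the partial sums by ε bounds the (possibly
-- irrational) total measure of the cover by ε.

MeasureZero : Pred Subset 0ℓ
MeasureZero A = (ε : ℚ) → 0ℚ ℚ.< ε →
  Σ[ c ∈ (ℕ → 2^ω × ℕ) ]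
    A ⊆ ⋃ ℕ (λ i → uncurry [_↾_] (c i)) ×
    ((k : ℕ) → sum +-0-rawMonoid {k} (λ i → measure (c (toℕ i))) ℚ.≤ ε)

Ideal : Set₂
Ideal = Pred Subset (lsuc 0ℓ)

-- The smallest σ-ideal including 𝓖.

data σ-ideal (𝓖 : Pred Subset 0ℓ) : Ideal where
  generator : {A : Subset} → A ∈ 𝓖 → A ∈ σ-ideal 𝓖
  empty     : ∅ ∈ σ-ideal 𝓖
  subset    : {A B : Subset} → A ⊆ B → B ∈ σ-ideal 𝓖 → A ∈ σ-ideal 𝓖
  union     : (A : ℕ → Subset) → ((n : ℕ) → A n ∈ σ-ideal 𝓖) → ⋃ ℕ A ∈ σ-ideal 𝓖

𝓜 : Ideal
𝓜 X = Σ[ N ∈ (ℕ → Subset) ] ((n : ℕ) → NowhereDense (N n)) × X ≐ ⋃ ℕ N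

𝓔 : Ideal
𝓔 = σ-ideal (λ A → Closed A × MeasureZero A)

𝒫[2^ω] : Setoid (lsuc 0ℓ) 0ℓ
𝒫[2^ω] = ≐-setoid 2^ω 0ℓ

-- The union of a family of subsets is a subset only up to resizing (it
-- quantifies over Subset), so it is specified rather than defined.

_IsUnionOf_ : Subset → Family 𝒫[2^ω] → Set₁
U IsUnionOf 𝓕 = (x : 2^ω) → x ∈ U ⇔ (Σ[ F ∈ Subset ] F ∈ 𝓕 × x ∈ F)

-- For each cardinal invariant, Is-inv κ says that κ is (the cardinal) inv.

module _ (𝓘 : Ideal) where

  Is-add : Set → Set₁
  Is-add = IsMinCard 𝒫[2^ω] λ 𝓕 →
    𝓕 ⊆ 𝓘 × (Σ[ U ∈ Subset ] U IsUnionOf 𝓕 × U ∉ 𝓘)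

  Is-cof : Set → Set₁
  Is-cof = IsMinCard 𝒫[2^ω] λ 𝓕 →
    𝓕 ⊆ 𝓘 × ((Y : Subset) → Y ∈ 𝓘 → Σ[ Y′ ∈ Subset ] Y′ ∈ 𝓕 × Y ⊆ Y′)

  Is-add*ₜ : Set → Set₁
  Is-add*ₜ = IsMinCard 𝒫[2^ω] λ 𝓕 →
    𝓕 ⊆ 𝓘 ×
    ¬ (Σ[ X ∈ Subset ] X ∈ 𝓘 ×
         ((F : Subset) → F ∈ 𝓕 → Σ[ x ∈ 2^ω ] F +ₜ x ⊆ X))

  Is-cof*ₜ : Set → Set₁
  Is-cof*ₜ = IsMinCard 𝒫[2^ω] λ 𝓕 →
    𝓕 ⊆ 𝓘 ×
    ((Y : Subset) → Y ∈ 𝓘 →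
       Σ[ Y′ ∈ Subset ] Y′ ∈ 𝓕 × (Σ[ x ∈ 2^ω ] Y ⊆ Y′ +ₜ x))

ω^ω : Setoid 0ℓ 0ℓ
ω^ω = ℕ →-setoid ℕ

infix 4 _≤*_

_≤*_ : (ℕ → ℕ) → (ℕ → ℕ) → Set
f ≤* g = Σ[ m ∈ ℕ ] ((n : ℕ) → m ℕ.≤ n → f n ℕ.≤ g n)

Is-𝔟 : Set → Set₁
Is-𝔟 = IsMinCard ω^ω λ 𝓕 →
  ¬ (Σ[ g ∈ (ℕ → ℕ) ] ((f : ℕ → ℕ) → f ∈ 𝓕 → f ≤* g))

Is-𝔡 : Set → Set₁
Is-𝔡 = IsMinCard ω^ω λ 𝓕 →
  (g : ℕ → ℕ) → Σ[ f ∈ (ℕ → ℕ) ] f ∈ 𝓕 × g ≤* f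

module Submission where

-- Both parts follow from two pairs of maps (Tukey connections).
--
-- From 𝓔 to 𝓜.  Write F ∈ 𝓔 as an increasing union of sets B n whose closures
-- are null, and let a point y of 2^ω guess clopen sets: the word 1^(i+1) 0 at
-- position n stands for the i-th clopen set, which counts if its measure is at
-- most 2⁻ⁿ and if it includes B n.  The points with only finitely many such
-- correct guesses form a meager set.  If that set is included in M ∈ 𝓜, take a
-- point t and a partition of ω into blocks such that every point that agrees
-- with t on infinitely many blocks is outside M.  Then t guesses correctly in
-- almost all blocks, so F is included in the set of the points which, in almost
-- all blocks, belong to a clopen set guessed by t.  This set is in 𝓔 and depends
-- on M alone.
--
-- From (ω^ω , ≤*) to 𝓔.  Let D be a set whose j-th element is at least f j.  The
-- points that vanish on D form a closed null set.  If a translate of it is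
-- included in a union of sets A n with null closures, then f is dominated by a
-- function read off the depths of finite covers of the A n: at a j where f j
-- is larger than the depth of a cover of A n of measure below 2^-(j+m), choosing
-- the bits outside D one at a time finds a point of the translate, with a
-- prescribed restriction to m, outside that cover.  Repeating this for all n
-- gives a point of the translate outside the union.

open import Algebra.Bundles using (CommutativeMonoid)
open import Axiom.ExcludedMiddle using (ExcludedMiddle)
open import Data.Bool.Base using (Bool; true; false; _xor_; _∨_; if_then_else_)
open import Data.Bool.Properties using (∨-zeroʳ; T-≡; xor-assoc; xor-same; xor-identityʳ)
open import Data.Empty using (⊥)
open import Data.Fin.Base using (toℕ)
import Data.Integer.Base as ℤ
import Data.Integer.Properties as ℤ
open import Data.List.Base using (List; []; _∷_; _++_; map; length; upTo; cartesianProduct)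
open import Data.List.Membership.Propositional.Properties using (∈-upTo⁺)
open import Data.List.Properties using (map-++; ++-identityʳ)
open import Data.List.Relation.Unary.All as All using (All; []; _∷_)
open import Data.List.Relation.Unary.Any as Any using (Any; here; there)
import Data.List.Relation.Unary.Any.Properties as Any
open import Data.Nat.Base as ℕ using (ℕ; zero; suc; s≤s; z≤n; _∸_)
import Data.Nat.Properties as ℕ
open import Data.Product.Base using (Σ-syntax; _×_; _,_; proj₁; proj₂; uncurry)
open import Data.Rational.Base as ℚ using (ℚ; 0ℚ; 1ℚ; ½; +-*-rawSemiring; +-0-rawMonoid)
import Data.Rational.Properties as ℚ
import Data.Rational.Unnormalised as ℚᵘ
import Data.Rational.Unnormalised.Properties as ℚᵘ
open import Data.Sum.Base using (_⊎_; inj₁; inj₂)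
open import Function.Base using (_∘_; id; const)
open import Function.Bundles using (_↣_; mk↣; mk⇔; Injection; Bijection; Equivalence)
open import Level using (Level; 0ℓ)
open import Relation.Binary.Bundles using (Setoid)
open import Relation.Binary.Definitions using (tri<; tri≈; tri>)
open import Relation.Binary.PropositionalEquality
  using (_≡_; _≗_; refl; sym; trans; cong; cong₂; subst; subst₂; module ≡-Reasoning)
open import Relation.Nullary using (¬_; yes; no; does; contradiction)
open import Relation.Nullary.Decidable using (decidable-stable; dec-true; dec-false)
open import Relation.Unary using (Pred; _∈_; _∉_; _⊆_; _≐_; _∩_; _∪_; ∅; ⋃)
open import Algebra.Definitions.RawMonoid +-0-rawMonoid using (sum)
open import Algebra.Definitions.RawSemiring +-*-rawSemiring using (_^_)
open import Algebra.Properties.CommutativeSemigroup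
  (CommutativeMonoid.commutativeSemigroup ℚ.+-0-commutativeMonoid) using (interchange)
open import Defs

-- Powers of ½

½^-split : ∀ n → ½ ^ suc n ℚ.+ ½ ^ suc n ≡ ½ ^ n
½^-split n = trans (sym (ℚ.*-distribʳ-+ (½ ^ n) ½ ½)) (ℚ.*-identityˡ (½ ^ n))

½^-pos : ∀ n → ℚ.Positive (½ ^ n)
½^-pos zero    = _
½^-pos (suc n) = ℚ.pos*pos⇒pos ½ (½ ^ n) {{½^-pos n}}

0<½^ : ∀ n → 0ℚ ℚ.< ½ ^ n
0<½^ n = ℚ.positive⁻¹ (½ ^ n) {{½^-pos n}}

½^-suc-< : ∀ n → ½ ^ suc n ℚ.< ½ ^ n
½^-suc-< n = subst₂ ℚ._<_ (ℚ.+-identityʳ _) (½^-split n)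
  (ℚ.+-monoʳ-< (½ ^ suc n) (0<½^ (suc n)))

½^-antitone : ∀ {m n} → m ℕ.≤ n → ½ ^ n ℚ.≤ ½ ^ m
½^-antitone {n = n} z≤n = go n
  where
  go : ∀ n → ½ ^ n ℚ.≤ 1ℚ
  go zero    = ℚ.≤-refl
  go (suc n) = ℚ.≤-trans (ℚ.<⇒≤ (½^-suc-< n)) (go n)
½^-antitone (s≤s m≤n) = ℚ.*-monoˡ-≤-nonNeg ½ (½^-antitone m≤n)


-- The term `ℚᵘ.mkℚᵘ (ℤ.+ 1) n` is 1/(n+1), as denominators are stored minus one. The induction step
-- is n + 2 ≤ 2(n + 1).
½^≤1/suc : ∀ n → ℚ.toℚᵘ (½ ^ n) ℚᵘ.≤ ℚᵘ.mkℚᵘ (ℤ.+ 1) n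
½^≤1/suc zero    = ℚᵘ.≤-refl
½^≤1/suc (suc n) = begin
  ℚ.toℚᵘ (½ ℚ.* ½ ^ n)                  ≃⟨ ℚ.toℚᵘ-homo-* ½ (½ ^ n) ⟩
  ℚ.toℚᵘ ½ ℚᵘ.* ℚ.toℚᵘ (½ ^ n)          ≤⟨ ℚᵘ.*-monoʳ-≤-nonNeg (ℚ.toℚᵘ ½) (½^≤1/suc n) ⟩
  ℚ.toℚᵘ ½ ℚᵘ.* ℚᵘ.mkℚᵘ (ℤ.+ 1) n       ≤⟨ ℚᵘ.*≤* (ℤ.+≤+ (ℕ.*-monoʳ-≤ 1 2+n≤2*[1+n])) ⟩
  ℚᵘ.mkℚᵘ (ℤ.+ 1) (suc n)               ∎
  where
  open ℚᵘ.≤-Reasoning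
  2+n≤2*[1+n] : 2 ℕ.+ n ℕ.≤ 2 ℕ.* suc n
  2+n≤2*[1+n] = s≤s (ℕ.≤-trans (ℕ.m≤m+n (suc n) (n ℕ.+ 0)) (ℕ.≤-reflexive (sym (ℕ.+-suc n (n ℕ.+ 0)))))

-- A positive ε is (a+1)/(d+1) ≥ 1/(d+1), so the stored field d serves as the exponent.
½^-archimedean : ∀ ε → 0ℚ ℚ.< ε → Σ[ n ∈ ℕ ] ½ ^ n ℚ.≤ ε
½^-archimedean (ℚ.mkℚ (ℤ.+ zero) d c)      0<ε = contradiction (ℚ.positive 0<ε) λ ()
½^-archimedean (ℚ.mkℚ (ℤ.-[1+ a ]) d c)    0<ε = contradiction (ℚ.positive 0<ε) λ ()
½^-archimedean (ℚ.mkℚ (ℤ.+ suc a) d c) 0<ε = d , ℚ.toℚᵘ-cancel-≤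
  (ℚᵘ.≤-trans (½^≤1/suc d) (ℚᵘ.*≤* (ℤ.*-monoʳ-≤-nonNeg (ℤ.+ suc d) (ℤ.+≤+ (s≤s (z≤n {a}))))))

-- The Cantor space

↾-refl : ∀ {x n} → [ x ↾ n ] x
↾-refl _ _ = refl

↾-sym : ∀ {x y n} → [ x ↾ n ] y → [ y ↾ n ] x
↾-sym e i i<n = sym (e i i<n)

↾-trans : ∀ {x y z n} → [ x ↾ n ] y → [ y ↾ n ] z → [ x ↾ n ] z
↾-trans e f i i<n = trans (f i i<n) (e i i<n)

↾-≤ : ∀ {x y m n} → m ℕ.≤ n → [ x ↾ n ] y → [ x ↾ m ] y
↾-≤ m≤n e i i<m = e i (ℕ.≤-trans i<m m≤n)

-- Limits of finite approximations: only the first `level s` bits of `point s` count, and each step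
-- keeps them and settles at least one more.
module Fusion {a} {S : Set a} (point : S → 2^ω) (level : S → ℕ) (next : ℕ → S → S)
  (level-next : ∀ l s → level s ℕ.< level (next l s))
  (point-next : ∀ l s → [ point s ↾ level s ] (point (next l s)))
  (start : S) where

  stage : ℕ → S
  stage zero    = start
  stage (suc l) = next l (stage l)

  level-stage : ∀ l → l ℕ.≤ level (stage l)
  level-stage zero    = z≤n
  level-stage (suc l) = ℕ.≤-<-trans (level-stage l) (level-next l (stage l))

  point-stage : ∀ d l → [ point (stage l) ↾ level (stage l) ] (point (stage (d ℕ.+ l)))
  point-stage zero    l = ↾-refl
  point-stage (suc d) l = ↾-trans (point-stage d l)
    (↾-≤ (level-mono d) (point-next (d ℕ.+ l) (stage (d ℕ.+ l))))
    where
    level-mono : ∀ d → level (stage l) ℕ.≤ level (stage (d ℕ.+ l))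
    level-mono zero    = ℕ.≤-refl
    level-mono (suc d) = ℕ.≤-trans (level-mono d) (ℕ.<⇒≤ (level-next (d ℕ.+ l) (stage (d ℕ.+ l))))

  limit : 2^ω
  -- Stage i + 1 has level at least i + 1, so its bit i is final.
  limit i = point (stage (suc i)) i

  limit-↾ : ∀ l → [ point (stage l) ↾ level (stage l) ] limit
  limit-↾ l i i<lv with ℕ.≤-total l (suc i)
  ... | inj₁ l≤1+i = trans (cong (λ k → point (stage k) i) (sym (ℕ.m∸n+n≡m l≤1+i)))
                       (point-stage (suc i ∸ l) l i i<lv)
  ... | inj₂ 1+i≤l = sym (trans (cong (λ k → point (stage k) i) (sym (ℕ.m∸n+n≡m 1+i≤l)))
                       (point-stage (l ∸ suc i) (suc i) i (level-stage (suc i))))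

-- Finite unions of cylinders and their weight

Cylinder : Set
Cylinder = 2^ω × ℕ

⟦_⟧ : List Cylinder → Subset
⟦ L ⟧ x = Any (λ c → uncurry [_↾_] c x) L

weight : List Cylinder → ℚ
weight []      = 0ℚ
weight (c ∷ L) = measure c ℚ.+ weight L

weight-++ : ∀ L L′ → weight (L ++ L′) ≡ weight L ℚ.+ weight L′
weight-++ []      L′ = sym (ℚ.+-identityˡ _)
weight-++ (c ∷ L) L′ = trans (cong (measure c ℚ.+_) (weight-++ L L′))
  (sym (ℚ.+-assoc (measure c) (weight L) (weight L′)))

depth : List Cylinder → ℕ
depth []      = 0
depth (c ∷ L) = proj₂ c ℕ.⊔ depth L

⟦⟧-determined : ∀ L {x y} → [ x ↾ depth L ] y → x ∈ ⟦ L ⟧ → y ∈ ⟦ L ⟧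
⟦⟧-determined (c ∷ L) e (here p)  = here (↾-trans p (↾-≤ (ℕ.m≤m⊔n _ (depth L)) e))
⟦⟧-determined (c ∷ L) e (there p) = there (⟦⟧-determined L (↾-≤ (ℕ.m≤n⊔m (proj₂ c) _) e) p)

-- The padding has total measure ½ ^ N.

pad : List Cylinder → ℕ → ℕ → Cylinder
pad []      N zero    = const false , suc N
pad []      N (suc i) = pad [] (suc N) i
pad (c ∷ L) N zero    = c
pad (c ∷ L) N (suc i) = pad L N i

partialSum : (ℕ → Cylinder) → ℕ → ℚ
partialSum c k = sum {k} (λ i → measure (c (toℕ i)))

partialSum-pad-≤ : ∀ L N k → partialSum (pad L N) k ℚ.≤ weight L ℚ.+ ½ ^ N
partialSum-pad-≤ []      N zero    = begin
  0ℚ             ≤⟨ ℚ.<⇒≤ (0<½^ N) ⟩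
  ½ ^ N          ≡⟨ ℚ.+-identityˡ (½ ^ N) ⟨
  0ℚ ℚ.+ ½ ^ N   ∎
  where open ℚ.≤-Reasoning
partialSum-pad-≤ []      N (suc k) = begin
  ½ ^ suc N ℚ.+ partialSum (pad [] (suc N)) k   ≤⟨ ℚ.+-monoʳ-≤ (½ ^ suc N) (partialSum-pad-≤ [] (suc N) k) ⟩
  ½ ^ suc N ℚ.+ (0ℚ ℚ.+ ½ ^ suc N)              ≡⟨ cong (½ ^ suc N ℚ.+_) (ℚ.+-identityˡ (½ ^ suc N)) ⟩
  ½ ^ suc N ℚ.+ ½ ^ suc N                       ≡⟨ ½^-split N ⟩
  ½ ^ N                                         ≡⟨ ℚ.+-identityˡ (½ ^ N) ⟨
  0ℚ ℚ.+ ½ ^ N                                  ∎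
  where open ℚ.≤-Reasoning
partialSum-pad-≤ (c ∷ L) N zero    = begin
  0ℚ                                     ≤⟨ partialSum-pad-≤ L N zero ⟩
  weight L ℚ.+ ½ ^ N                     ≡⟨ ℚ.+-identityˡ (weight L ℚ.+ ½ ^ N) ⟨
  0ℚ ℚ.+ (weight L ℚ.+ ½ ^ N)            ≤⟨ ℚ.+-monoˡ-≤ (weight L ℚ.+ ½ ^ N) (ℚ.<⇒≤ (0<½^ (proj₂ c))) ⟩
  measure c ℚ.+ (weight L ℚ.+ ½ ^ N)     ≡⟨ ℚ.+-assoc (measure c) (weight L) (½ ^ N) ⟨
  weight (c ∷ L) ℚ.+ ½ ^ N               ∎
  where open ℚ.≤-Reasoning
partialSum-pad-≤ (c ∷ L) N (suc k) = begin
  measure c ℚ.+ partialSum (pad L N) k   ≤⟨ ℚ.+-monoʳ-≤ (measure c) (partialSum-pad-≤ L N k) ⟩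
  measure c ℚ.+ (weight L ℚ.+ ½ ^ N)     ≡⟨ ℚ.+-assoc (measure c) (weight L) (½ ^ N) ⟨
  weight (c ∷ L) ℚ.+ ½ ^ N               ∎
  where open ℚ.≤-Reasoning

⟦⟧⊆pad : ∀ L N → ⟦ L ⟧ ⊆ ⋃ ℕ (λ i → uncurry [_↾_] (pad L N i))
⟦⟧⊆pad (c ∷ L) N (here p)  = zero , p
⟦⟧⊆pad (c ∷ L) N (there p) = let i , q = ⟦⟧⊆pad L N p in suc i , q

firstCylinders : (ℕ → Cylinder) → ℕ → List Cylinder
firstCylinders c zero    = []
firstCylinders c (suc k) = c 0 ∷ firstCylinders (c ∘ suc) k

weight-first : ∀ c k → weight (firstCylinders c k) ≡ partialSum c k
weight-first c zero    = refl
weight-first c (suc k) = cong (measure (c 0) ℚ.+_) (weight-first (c ∘ suc) k)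

∈-first : ∀ c k {i x} → i ℕ.< k → uncurry [_↾_] (c i) x → x ∈ ⟦ firstCylinders c k ⟧
∈-first c (suc k) {zero}  _         p = here p
∈-first c (suc k) {suc i} (s≤s i<k) p = there (∈-first (c ∘ suc) k i<k p)

first-mono : ∀ c {k k′} → k ℕ.≤ k′ → ⟦ firstCylinders c k ⟧ ⊆ ⟦ firstCylinders c k′ ⟧
first-mono c (s≤s k≤k′) (here p)  = here p
first-mono c (s≤s k≤k′) (there p) = there (first-mono (c ∘ suc) k≤k′ p)

↾-suc : ∀ {x y n} → [ x ↾ n ] y → y n ≡ x n → [ x ↾ suc n ] y
↾-suc e yn≡xn i (s≤s i≤n) with ℕ.m≤n⇒m<n∨m≡n i≤n
... | inj₁ i<n  = e i i<n
... | inj₂ refl = yn≡xn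

infix 10 _[_≔_]

_[_≔_] : 2^ω → ℕ → Bool → 2^ω
(x [ n ≔ b ]) i = if does (i ℕ.≟ n) then b else x i

≔-at : ∀ x n b → (x [ n ≔ b ]) n ≡ b
≔-at x n b rewrite dec-true (n ℕ.≟ n) refl = refl

≔-below : ∀ x n b → [ x ↾ n ] (x [ n ≔ b ])
≔-below x n b i i<n rewrite dec-false (i ℕ.≟ n) (ℕ.<⇒≢ i<n) = refl

↾-≔ : ∀ {x y n} → [ x ↾ n ] y → [ x [ n ≔ y n ] ↾ suc n ] y
↾-≔ {x} {y} {n} e = ↾-suc (↾-trans (↾-sym (≔-below x n (y n))) e) (sym (≔-at x n (y n)))

-- By compactness, this says that the closure of A has measure zero.

CompactNull : Subset → Set
CompactNull A = ∀ m → Σ[ L ∈ List Cylinder ] weight L ℚ.≤ ½ ^ m × A ⊆ ⟦ L ⟧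

∅-compactNull : CompactNull ∅
∅-compactNull m = [] , ℚ.<⇒≤ (0<½^ m) , λ ()

-- Compactness of closed sets

module _ (em : ExcludedMiddle 0ℓ) where

  dne : {P : Set} → ¬ ¬ P → P
  dne = decidable-stable em

  ¬∀⇒∃¬ : {A : Set} {P : A → Set} → ¬ (∀ a → P a) → Σ[ a ∈ A ] ¬ P a
  ¬∀⇒∃¬ ¬∀ = dne λ ¬∃ → ¬∀ λ a → dne λ ¬Pa → ¬∃ (a , ¬Pa)

  module _ {X : Subset} (X-closed : Closed X) (c : ℕ → Cylinder)
    (X⊆c : X ⊆ ⋃ ℕ (λ i → uncurry [_↾_] (c i))) where

    FinitelyCovered : 2^ω → ℕ → Set
    FinitelyCovered x n = Σ[ k ∈ ℕ ] [ x ↾ n ] ∩ X ⊆ ⟦ firstCylinders c k ⟧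

    finitelyCovered-split : ∀ {x n} → (∀ b → FinitelyCovered (x [ n ≔ b ]) (suc n)) →
                            FinitelyCovered x n
    finitelyCovered-split {x} {n} h = k false ℕ.⊔ k true , λ {y} (y∈[x] , y∈X) →
      first-mono c (k≤ (y n)) (proj₂ (h (y n)) (↾-≔ y∈[x] , y∈X))
      where
      k : Bool → ℕ
      k b = proj₁ (h b)
      k≤ : ∀ b → k b ℕ.≤ k false ℕ.⊔ k true
      k≤ false = ℕ.m≤m⊔n (k false) (k true)
      k≤ true  = ℕ.m≤n⊔m (k false) (k true)

    -- König's argument: a cylinder that is not finitely covered has a half that is not, and the
    -- chosen halves shrink to a limit point. This point is in X, since a cylinder disjoint from X
    -- is covered by no cylinders at all; but then a single `c i` covers a neighbourhood of it.
    compactness : Σ[ k ∈ ℕ ] X ⊆ ⟦ firstCylinders c k ⟧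
    compactness = dne λ ¬fin → ¬limit (const false , 0 , λ (k , p) → ¬fin (k , λ {_} x∈X → p ((λ _ ()) , x∈X)))
      where
      State : Set
      State = Σ[ x ∈ 2^ω ] Σ[ n ∈ ℕ ] ¬ FinitelyCovered x n

      next : State → State
      next (x , n , ¬fc) = let b , ¬fcb = ¬∀⇒∃¬ (¬fc ∘ finitelyCovered-split)
                           in x [ n ≔ b ] , suc n , ¬fcb

      ¬limit : State → ⊥
      ¬limit s = contradiction limit∈X limit∉X
        where
        open Fusion proj₁ (proj₁ ∘ proj₂) (λ _ → next) (λ _ _ → ℕ.≤-refl)
                    (λ _ (x , n , _) → ≔-below x n _) s
        ¬covered : ∀ l → ¬ FinitelyCovered limit l
        ¬covered l (k , p) = proj₂ (proj₂ (stage l)) (k , λ {_} (y∈ , y∈X) →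
          p (↾-≤ (level-stage l) (↾-trans (↾-sym (limit-↾ l)) y∈) , y∈X))
        limit∈X : limit ∈ X
        limit∈X = dne λ ∉X → let n , q = X-closed ∉X in ¬covered n (0 , λ {_} (y∈ , y∈X) → contradiction y∈X (q y∈))
        limit∉X : limit ∉ X
        limit∉X ∈X = let i , p = X⊆c ∈X in
          ¬covered (proj₂ (c i)) (suc i , λ {_} (y∈ , _) → ∈-first c (suc i) ℕ.≤-refl (↾-trans p y∈))

  closed-null⇒compactNull : ∀ {A} → Closed A → MeasureZero A → CompactNull A
  closed-null⇒compactNull A-closed A-null m =
    let c , A⊆c , sums≤ = A-null (½ ^ m) (0<½^ m)
        k , A⊆L = compactness A-closed c A⊆c
    in firstCylinders c k , subst (ℚ._≤ ½ ^ m) (sym (weight-first c k)) (sums≤ k) , A⊆L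

  -- The intersection of all the finite covers is a closed null set that includes A.
  compactNull⇒𝓔 : ∀ {A} → CompactNull A → A ∈ 𝓔
  compactNull⇒𝓔 {A} A-null = subset A⊆Ā (generator (Ā-closed , Ā-null))
    where
    L : ℕ → List Cylinder
    L m = proj₁ (A-null m)
    Ā : Subset
    Ā x = ∀ m → x ∈ ⟦ L m ⟧
    A⊆Ā : A ⊆ Ā
    A⊆Ā x∈A m = proj₂ (proj₂ (A-null m)) x∈A
    Ā-closed : Closed Ā
    Ā-closed x∉Ā = let m , x∉ = ¬∀⇒∃¬ x∉Ā in
      depth (L m) , λ y∈[x] y∈Ā → x∉ (⟦⟧-determined (L m) (↾-sym y∈[x]) (y∈Ā m))
    Ā-null : MeasureZero Ā
    -- Half of ½ ^ n goes to the finite cover, half to the padding that makes it an infinite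
    -- sequence.
    Ā-null ε 0<ε = let n , ½^n≤ε = ½^-archimedean ε 0<ε
                       M = L (suc n)
                   in pad M (suc n) , (λ x∈Ā → ⟦⟧⊆pad M (suc n) (x∈Ā (suc n))) , λ k → begin
      partialSum (pad M (suc n)) k    ≤⟨ partialSum-pad-≤ M (suc n) k ⟩
      weight M ℚ.+ ½ ^ suc n          ≤⟨ ℚ.+-monoˡ-≤ (½ ^ suc n) (proj₁ (proj₂ (A-null (suc n)))) ⟩
      ½ ^ suc n ℚ.+ ½ ^ suc n         ≡⟨ ½^-split n ⟩
      ½ ^ n                           ≤⟨ ½^n≤ε ⟩
      ε                               ∎
      where open ℚ.≤-Reasoning

-- Enumerations

-- Walks along the antidiagonals: within one, a decreases and b increases; after (0 , b) comes the
-- next one.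
nextPair : ℕ × ℕ → ℕ × ℕ
nextPair (zero  , b) = suc b , 0
nextPair (suc a , b) = a , suc b

unpair : ℕ → ℕ × ℕ
unpair zero    = 0 , 0
unpair (suc n) = nextPair (unpair n)

unpair-surjective : ∀ a b → Σ[ n ∈ ℕ ] unpair n ≡ (a , b)
unpair-surjective a b = go (a ℕ.+ b) a b refl
  where
  -- The recursion is lexicographic in s and b, going back along the walk.
  go : ∀ s a b → a ℕ.+ b ≡ s → Σ[ n ∈ ℕ ] unpair n ≡ (a , b)
  go s       a       (suc b) p with n , q ← go s (suc a) b (trans (sym (ℕ.+-suc a b)) p)
    = suc n , cong nextPair q
  go (suc s) (suc a) zero    p with n , q ← go s 0 a (trans (sym (ℕ.+-identityʳ a)) (ℕ.suc-injective p))
    = suc n , cong nextPair q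
  go zero    zero    zero    p = 0 , refl

-- A countable dense set of points: a codes the first bit and a code of the remaining ones.
bits : ℕ → 2^ω
bits a zero    = does (0 ℕ.<? proj₁ (unpair a))
bits a (suc i) = bits (proj₂ (unpair a)) i

bits-dense : ∀ x n → Σ[ a ∈ ℕ ] [ x ↾ n ] (bits a)
bits-dense x zero    = 0 , λ _ ()
bits-dense x (suc n) with a′ , e ← bits-dense (x ∘ suc) n
                     with a , q ← unpair-surjective (if x 0 then 1 else 0) a′
  = a , agree
  where
  digit : ∀ b → does (0 ℕ.<? (if b then 1 else 0)) ≡ b
  digit false = refl
  digit true  = refl
  agree : [ x ↾ suc n ] (bits a)
  agree zero    _         rewrite q = digit (x 0)
  agree (suc i) (s≤s i<n) rewrite q = e i i<n

cylinderAt : ℕ → Cylinder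
cylinderAt a = bits (proj₁ (unpair a)) , proj₂ (unpair a)

listAt : ℕ → ℕ → List Cylinder
listAt zero    a = []
listAt (suc k) a = cylinderAt (proj₁ (unpair a)) ∷ listAt k (proj₂ (unpair a))

-- The enumerated point agrees with that of c only below the level, so cylinders are compared by
-- level and inclusion instead of identity.
cylinderAt-surjective : ∀ c → Σ[ a ∈ ℕ ] proj₂ (cylinderAt a) ≡ proj₂ c ×
                              uncurry [_↾_] c ⊆ uncurry [_↾_] (cylinderAt a)
cylinderAt-surjective (x , n) with b , e ← bits-dense x n
                              with a , q ← unpair-surjective b n
  = a , cong proj₂ q ,
    subst (λ p → [ x ↾ n ] ⊆ [ bits (proj₁ p) ↾ proj₂ p ]) (sym q) (λ p → ↾-trans (↾-sym e) p)

listAt-surjective : ∀ L → Σ[ a ∈ ℕ ] weight (listAt (length L) a) ≡ weight L ×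
                          ⟦ L ⟧ ⊆ ⟦ listAt (length L) a ⟧
listAt-surjective []      = 0 , refl , λ ()
listAt-surjective (c ∷ L) with b , n≡ , c⊆ ← cylinderAt-surjective c
                          with a , w , L⊆ ← listAt-surjective L
                          with d , q ← unpair-surjective b a
  = d , subst (λ p → weight (code p) ≡ weight (c ∷ L) × ⟦ c ∷ L ⟧ ⊆ ⟦ code p ⟧) (sym q)
      (cong₂ ℚ._+_ (cong (½ ^_) n≡) w , λ { (here p) → here (c⊆ p) ; (there p) → there (L⊆ p) })
  where
  code : ℕ × ℕ → List Cylinder
  code p = cylinderAt (proj₁ p) ∷ listAt (length L) (proj₂ p)

clopen : ℕ → List Cylinder
clopen i = listAt (proj₁ (unpair i)) (proj₂ (unpair i))

clopen-surjective : ∀ L → Σ[ i ∈ ℕ ] weight (clopen i) ≡ weight L × ⟦ L ⟧ ⊆ ⟦ clopen i ⟧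
clopen-surjective L with a , w , L⊆ ← listAt-surjective L
                    with i , q ← unpair-surjective (length L) a
  = i , subst (λ p → weight (listAt (proj₁ p) (proj₂ p)) ≡ weight L × ⟦ L ⟧ ⊆ ⟦ listAt (proj₁ p) (proj₂ p) ⟧)
          (sym q) (w , L⊆)

-- Representatives of the restrictions to k of the points that vanish on D.

prefixes : (ℕ → Bool) → ℕ → List 2^ω
prefixes D zero    = const false ∷ []
prefixes D (suc k) = map (_[ k ≔ false ]) (prefixes D k) ++
                     (if D k then [] else map (_[ k ≔ true ]) (prefixes D k))

prefixes-complete : ∀ D {x} → (∀ i → D i ≡ true → x i ≡ false) →
                    ∀ k → Any (λ y → [ y ↾ k ] x) (prefixes D k)
prefixes-complete D         x∈ zero    = here λ _ ()
prefixes-complete D {x = x} x∈ (suc k) with x k in xk | D k in Dk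
... | false | _     = Any.++⁺ˡ (Any.map⁺ (Any.map extend (prefixes-complete D x∈ k)))
  where
  extend : ∀ {y} → [ y ↾ k ] x → [ y [ k ≔ false ] ↾ suc k ] x
  extend {y} e = subst (λ b → [ y [ k ≔ b ] ↾ suc k ] x) xk (↾-≔ e)
... | true  | false = Any.++⁺ʳ (map (_[ k ≔ false ]) (prefixes D k)) (Any.map⁺ (Any.map extend (prefixes-complete D x∈ k)))
  where
  extend : ∀ {y} → [ y ↾ k ] x → [ y [ k ≔ true ] ↾ suc k ] x
  extend {y} e = subst (λ b → [ y [ k ≔ b ] ↾ suc k ] x) xk (↾-≔ e)
... | true  | true with () ← trans (sym xk) (x∈ k Dk)

cylinders : ℕ → List 2^ω → List Cylinder
cylinders k = map (_, k)

weight-cylinders-suc : ∀ k P → weight (cylinders (suc k) P) ≡ ½ ℚ.* weight (cylinders k P)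
weight-cylinders-suc k []      = sym (ℚ.*-zeroʳ ½)
weight-cylinders-suc k (x ∷ P) = trans (cong (½ ^ suc k ℚ.+_) (weight-cylinders-suc k P))
  (sym (ℚ.*-distribˡ-+ ½ (½ ^ k) (weight (cylinders k P))))

weight-cylinders-map : ∀ k g P → weight (cylinders k (map g P)) ≡ weight (cylinders k P)
weight-cylinders-map k g []      = refl
weight-cylinders-map k g (x ∷ P) = cong (½ ^ k ℚ.+_) (weight-cylinders-map k g P)

weight-cylinders-++ : ∀ k P Q → weight (cylinders k (P ++ Q)) ≡ weight (cylinders k P) ℚ.+ weight (cylinders k Q)
weight-cylinders-++ k P Q = trans (cong weight (map-++ (_, k) P Q)) (weight-++ (cylinders k P) (cylinders k Q))

count : (ℕ → Bool) → ℕ → ℕ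
count D zero    = 0
count D (suc k) = if D k then suc (count D k) else count D k

-- A position in D halves the weight, since one of the two extensions is dropped; any other position
-- preserves it.
weight-prefixes : ∀ D k → weight (cylinders k (prefixes D k)) ≡ ½ ^ count D k
weight-prefixes D zero    = ℚ.+-identityʳ 1ℚ
weight-prefixes D (suc k) with D k
... | true  = begin
  weight (cylinders (suc k) (map (_[ k ≔ false ]) P ++ []))   ≡⟨ cong (weight ∘ cylinders (suc k)) (++-identityʳ (map (_[ k ≔ false ]) P)) ⟩
  weight (cylinders (suc k) (map (_[ k ≔ false ]) P))         ≡⟨ weight-cylinders-map (suc k) (_[ k ≔ false ]) P ⟩
  weight (cylinders (suc k) P)                                ≡⟨ weight-cylinders-suc k P ⟩
  ½ ℚ.* weight (cylinders k P)                                ≡⟨ cong (½ ℚ.*_) (weight-prefixes D k) ⟩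
  ½ ^ suc (count D k)                                         ∎
  where
  open ≡-Reasoning
  P = prefixes D k
... | false = begin
  weight (cylinders (suc k) (map (_[ k ≔ false ]) P ++ map (_[ k ≔ true ]) P))
    ≡⟨ weight-cylinders-++ (suc k) (map (_[ k ≔ false ]) P) (map (_[ k ≔ true ]) P) ⟩
  weight (cylinders (suc k) (map (_[ k ≔ false ]) P)) ℚ.+ weight (cylinders (suc k) (map (_[ k ≔ true ]) P))
    ≡⟨ cong₂ ℚ._+_ (half false) (half true) ⟩
  ½ ^ suc (count D k) ℚ.+ ½ ^ suc (count D k)
    ≡⟨ ½^-split (count D k) ⟩
  ½ ^ count D k ∎
  where
  open ≡-Reasoning
  P = prefixes D k
  half : ∀ b → weight (cylinders (suc k) (map (_[ k ≔ b ]) P)) ≡ ½ ^ suc (count D k)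
  half b = trans (weight-cylinders-map (suc k) (_[ k ≔ b ]) P)
    (trans (weight-cylinders-suc k P) (cong (½ ℚ.*_) (weight-prefixes D k)))

-- Ideals and Baire category

∪-compactNull : ∀ {A B} → CompactNull A → CompactNull B → CompactNull (A ∪ B)
∪-compactNull A-null B-null m with L , wL , A⊆ ← A-null (suc m) | L′ , wL′ , B⊆ ← B-null (suc m)
  = L ++ L′ ,
    subst₂ ℚ._≤_ (sym (weight-++ L L′)) (½^-split m) (ℚ.+-mono-≤ wL wL′) ,
    λ { (inj₁ x∈A) → Any.++⁺ˡ (A⊆ x∈A) ; (inj₂ x∈B) → Any.++⁺ʳ L (B⊆ x∈B) }

initialUnion : (ℕ → Subset) → ℕ → Subset
initialUnion A zero    = A 0
initialUnion A (suc n) = initialUnion A n ∪ A (suc n)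

initialUnion-compactNull : ∀ {A} → (∀ n → CompactNull (A n)) → ∀ n → CompactNull (initialUnion A n)
initialUnion-compactNull A-null zero    = A-null 0
initialUnion-compactNull A-null (suc n) = ∪-compactNull (initialUnion-compactNull A-null n) (A-null (suc n))

⊆-initialUnion : ∀ A n → A n ⊆ initialUnion A n
⊆-initialUnion A zero    x∈ = x∈
⊆-initialUnion A (suc n) x∈ = inj₂ x∈

initialUnion-mono : ∀ A {m n} → m ℕ.≤ n → initialUnion A m ⊆ initialUnion A n
initialUnion-mono A {m} {zero}  z≤n x∈ = x∈
initialUnion-mono A {m} {suc n} m≤  x∈ with ℕ.m≤n⇒m<n∨m≡n m≤
... | inj₁ (s≤s m≤n) = inj₁ (initialUnion-mono A m≤n x∈)
... | inj₂ refl      = x∈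

-- Block form of meager sets

splice : 2^ω → 2^ω → ℕ → 2^ω
splice x t k i = if does (i ℕ.<? k) then x i else t i

splice-below : ∀ x t k → [ x ↾ k ] (splice x t k)
splice-below x t k i i<k rewrite dec-true (i ℕ.<? k) i<k = refl

splice-above : ∀ x t k i → k ℕ.≤ i → splice x t k i ≡ t i
splice-above x t k i k≤i rewrite dec-false (i ℕ.<? k) (ℕ.≤⇒≯ k≤i) = refl

AgreeOn : ℕ → ℕ → 2^ω → 2^ω → Set
AgreeOn k m t z = ∀ i → k ℕ.≤ i → i ℕ.< m → z i ≡ t i

-- The combinatorial characterization of meager sets: a point that matches t on infinitely many
-- blocks `[k l , k (suc l))` is outside every N j.
record BlockAvoidance (N : ℕ → Subset) : Set where
  field
    t     : 2^ω
    k     : ℕ → ℕ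
    k<    : ∀ l → k l ℕ.< k (suc l)
    -- A run of ones that starts in a block where t is copied must stop inside that block, so the
    -- whole word read there lies in it.
    t-end : ∀ l → t (ℕ.pred (k (suc l))) ≡ false
    avoid : ∀ l z → AgreeOn (k l) (k (suc l)) t z → ∀ j → j ℕ.≤ l → z ∉ N j

  l≤k : ∀ l → l ℕ.≤ k l
  l≤k zero    = z≤n
  l≤k (suc l) = ℕ.≤-<-trans (l≤k l) (k< l)

-- The word has at least one 1, so that nothing is read at a position where y is false.
Reads : 2^ω → ℕ → ℕ → Set
Reads y n i = (∀ j → j ℕ.≤ i → y (n ℕ.+ j) ≡ true) × y (n ℕ.+ suc i) ≡ false

Reads-unique : ∀ {y n i j} → Reads y n i → Reads y n j → i ≡ j
Reads-unique {y} {n} {i} {j} (ones , end) (ones′ , end′) with ℕ.<-cmp i j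
... | tri< i<j _ _ with () ← trans (sym end) (ones′ (suc i) i<j)
... | tri≈ _ i≡j _ = i≡j
... | tri> _ _ j<i with () ← trans (sym end′) (ones (suc j) j<i)

module _ (em : ExcludedMiddle 0ℓ) where

  𝓔⇒compactNulls : ∀ {X} → X ∈ 𝓔 → Σ[ A ∈ (ℕ → Subset) ] (∀ n → CompactNull (A n)) × X ⊆ ⋃ ℕ A
  𝓔⇒compactNulls (generator {A} (A-closed , A-null)) =
    const A , const (closed-null⇒compactNull em A-closed A-null) , λ x∈A → 0 , x∈A
  𝓔⇒compactNulls empty = const ∅ , const ∅-compactNull , λ ()
  𝓔⇒compactNulls (subset X⊆Y Y∈𝓔) =
    let A , A-null , Y⊆ = 𝓔⇒compactNulls Y∈𝓔 in A , A-null , Y⊆ ∘ X⊆Y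
  𝓔⇒compactNulls (union X X∈𝓔) =
    (λ p → A (proj₁ (unpair p)) (proj₂ (unpair p))) ,
    (λ p → proj₁ (proj₂ (𝓔⇒compactNulls (X∈𝓔 (proj₁ (unpair p))))) (proj₂ (unpair p))) ,
    λ { {x} (n , x∈Xn) → let m , x∈A = proj₂ (proj₂ (𝓔⇒compactNulls (X∈𝓔 n))) x∈Xn
                             p , p≡ = unpair-surjective n m
                         in p , subst (λ q → x ∈ A (proj₁ q) (proj₂ q)) (sym p≡) x∈A }
    where
    A : ℕ → ℕ → Subset
    A n = proj₁ (𝓔⇒compactNulls (X∈𝓔 n))

  -- Otherwise every cylinder around a point of `[ x ↾ k ]` would meet A, and `[ x ↾ k ]` would be
  -- included in the closure of A.
  nowhereDense-extend : ∀ {A} → NowhereDense A → ∀ x k →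
    Σ[ y ∈ 2^ω ] Σ[ m ∈ ℕ ] k ℕ.≤ m × [ x ↾ k ] y × (∀ z → [ y ↾ m ] z → z ∉ A)
  nowhereDense-extend nwd x k = dne em λ none → nwd x (k , λ {y} y∈ n → dne em λ disjoint →
    none (y , k ℕ.⊔ n , ℕ.m≤m⊔n k n , y∈ , λ z z∈ z∈A → disjoint (z , ↾-≤ (ℕ.m≤n⊔m k n) z∈ , z∈A)))

  module _ {N : ℕ → Subset} (N-nwd : ∀ n → NowhereDense (N n)) where

    -- The requirements (prefix of length k, index j) are met one at a time by lengthening a common
    -- word on `[k , m)`; lengthening preserves those already met.
    avoidList : ∀ k (R : List (2^ω × ℕ)) → Σ[ t ∈ 2^ω ] Σ[ m ∈ ℕ ] k ℕ.≤ m ×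
      All (λ (x , j) → ∀ z → [ x ↾ k ] z → AgreeOn k m t z → z ∉ N j) R
    avoidList k []            = const false , k , ℕ.≤-refl , []
    avoidList k ((x , j) ∷ R) =
      let t , m , k≤m , avoids = avoidList k R
          y , m′ , m≤m′ , y∈ , y-avoids = nowhereDense-extend (N-nwd j) (splice x t k) m
          y≡t : AgreeOn k m t y
          y≡t i k≤i i<m = trans (y∈ i i<m) (splice-above x t k i k≤i)
          x≡y : [ y ↾ k ] x
          x≡y i i<k = sym (trans (y∈ i (ℕ.<-≤-trans i<k k≤m)) (splice-below x t k i i<k))
      in y , m′ , ℕ.≤-trans k≤m m≤m′ ,
         (λ z z∈ z≡y → y-avoids z λ i i<m′ → case-< k i
            (λ i<k → ↾-trans x≡y z∈ i i<k) (λ k≤i → z≡y i k≤i i<m′)) ∷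
         All.map (λ av z z∈ z≡y → av z z∈ λ i k≤i i<m →
            trans (z≡y i k≤i (ℕ.<-≤-trans i<m m≤m′)) (y≡t i k≤i i<m)) avoids
      where
      case-< : ∀ k i {P : Set} → (i ℕ.< k → P) → (k ℕ.≤ i → P) → P
      case-< k i lt ge with i ℕ.<? k
      ... | yes i<k = lt i<k
      ... | no  i≮k = ge (ℕ.≮⇒≥ i≮k)

    avoidBlock : ∀ l k → Σ[ t ∈ 2^ω ] Σ[ m ∈ ℕ ] k ℕ.≤ m ×
      (∀ z → AgreeOn k m t z → ∀ j → j ℕ.≤ l → z ∉ N j)
    avoidBlock l k =
      -- With an empty D, `prefixes` lists all words of length k, so the block works after every
      -- possible beginning.
      let t , m , k≤m , avoids = avoidList k (cartesianProduct (prefixes (const false) k) (upTo (suc l)))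
      in t , m , k≤m , λ z z≡t j j≤l → All.lookupWith {R = λ _ → z ∉ N j} (λ { {_ , _} av (z∈ , refl) → av z z∈ z≡t }) avoids
           (Any.cartesianProduct⁺ (prefixes-complete (const false) (λ _ ()) k) (∈-upTo⁺ (s≤s j≤l)))

    blockAvoidance : BlockAvoidance N
    blockAvoidance = record
      { t     = limit
      ; k     = proj₂ ∘ stage
      ; k<    = λ l → level-next l (stage l)
      ; t-end = λ l → trans (limit-↾ (suc l) _ ℕ.≤-refl) (next-end l (stage l))
      ; avoid = λ l z z≡t → next-avoid l (stage l) z
                  λ i k≤i i<m → trans (z≡t i k≤i i<m) (limit-↾ (suc l) i i<m)
      }
      where
      next : ℕ → 2^ω × ℕ → 2^ω × ℕ
      -- The extra bit at m provides `t-end`.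
      next l (x , k) = let t , m , _ = avoidBlock l k in splice x (t [ m ≔ false ]) k , suc m

      level-next : ∀ l s → proj₂ s ℕ.< proj₂ (next l s)
      level-next l (x , k) = s≤s (proj₁ (proj₂ (proj₂ (avoidBlock l k))))

      point-next : ∀ l s → [ proj₁ s ↾ proj₂ s ] (proj₁ (next l s))
      point-next l (x , k) = let t , m , _ = avoidBlock l k in splice-below x (t [ m ≔ false ]) k

      next-end : ∀ l s → proj₁ (next l s) (ℕ.pred (proj₂ (next l s))) ≡ false
      next-end l (x , k) = let t , m , k≤m , _ = avoidBlock l k
        in trans (splice-above x (t [ m ≔ false ]) k m k≤m) (≔-at t m false)

      next-avoid : ∀ l s z → AgreeOn (proj₂ s) (proj₂ (next l s)) (proj₁ (next l s)) z →
                   ∀ j → j ℕ.≤ l → z ∉ N j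
      next-avoid l (x , k) z z≡ = let t , m , k≤m , avoids = avoidBlock l k
        in avoids z λ i k≤i i<m → trans (z≡ i k≤i (ℕ.m≤n⇒m≤1+n i<m))
             (trans (splice-above x (t [ m ≔ false ]) k i k≤i) (≔-below t m false i i<m))

      open Fusion proj₁ proj₂ next level-next point-next (const false , 0)

-- From 𝓔 to 𝓜

Guesses : (ℕ → Subset) → ℕ → ℕ → Set
Guesses B n i = weight (clopen i) ℚ.≤ ½ ^ n × B n ⊆ ⟦ clopen i ⟧

Misses : (ℕ → Subset) → ℕ → Subset
Misses B m y = ∀ n → m ℕ.≤ n → ∀ i → Reads y n i → ¬ Guesses B n i

-- Any prefix of length k can be extended, by the word of a correct guess at n = k ⊔ m, to a
-- cylinder disjoint from `Misses B m`.
Misses-nowhereDense : ∀ {B} → (∀ n → CompactNull (B n)) → ∀ m → NowhereDense (Misses B m)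
Misses-nowhereDense {B} B-null m x (k , x∈Int) =
  let L , wL , B⊆L = B-null n n
      i , wi≡wL , L⊆i = clopen-surjective L
      ones = λ j → does (j ℕ.≤? n ℕ.+ i)
      y = splice x ones n
      -- This level includes the closing 0 at position n + i + 1.
      z , z∈ , misses = x∈Int {y} (↾-≤ (ℕ.m≤m⊔n k m) (splice-below x ones n)) (suc (n ℕ.+ suc i))
      read : ∀ j → j ℕ.≤ suc i → z (n ℕ.+ j) ≡ does (n ℕ.+ j ℕ.≤? n ℕ.+ i)
      read j j≤ = trans (z∈ (n ℕ.+ j) (s≤s (ℕ.+-monoʳ-≤ n j≤))) (splice-above x ones n (n ℕ.+ j) (ℕ.m≤m+n n j))
  in misses n (ℕ.m≤n⊔m k m) i
       ( (λ j j≤i → trans (read j (ℕ.m≤n⇒m≤1+n j≤i)) (dec-true (_ ℕ.≤? _) (ℕ.+-monoʳ-≤ n j≤i)))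
       , trans (read (suc i) ℕ.≤-refl) (dec-false (_ ℕ.≤? _) (ℕ.<⇒≱ (ℕ.+-monoʳ-< n ℕ.≤-refl))) )
       (subst (ℚ._≤ ½ ^ n) (sym wi≡wL) wL , L⊆i ∘ B⊆L)
  where
  n = k ℕ.⊔ m

module _ (em : ExcludedMiddle 0ℓ) {N : ℕ → Subset} (blocks : BlockAvoidance N) where

  open BlockAvoidance blocks

  guess : ℕ → List Cylinder
  guess n with em {Σ[ i ∈ ℕ ] Reads t n i × weight (clopen i) ℚ.≤ ½ ^ n}
  ... | yes (i , _) = clopen i
  ... | no  _       = []

  weight-guess : ∀ n → weight (guess n) ℚ.≤ ½ ^ n
  weight-guess n with em {Σ[ i ∈ ℕ ] Reads t n i × weight (clopen i) ℚ.≤ ½ ^ n}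
  ... | yes (_ , _ , w≤) = w≤
  ... | no  _            = ℚ.<⇒≤ (0<½^ n)

  guess-reads : ∀ {n i} → Reads t n i → weight (clopen i) ℚ.≤ ½ ^ n → guess n ≡ clopen i
  guess-reads {n} r w≤ with em {Σ[ i ∈ ℕ ] Reads t n i × weight (clopen i) ℚ.≤ ½ ^ n}
  ... | yes (_ , r′ , _) = cong clopen (Reads-unique {t} {n} r′ r)
  ... | no  none         = contradiction (_ , r , w≤) none

  guesses : ℕ → ℕ → List Cylinder
  guesses a zero    = []
  guesses a (suc d) = guess a ++ guesses (suc a) d

  -- A geometric series from a on, hence a bound independent of d.
  weight-guesses : ∀ a d → weight (guesses a d) ℚ.≤ ½ ^ a ℚ.+ ½ ^ a
  weight-guesses a zero    = ℚ.+-mono-≤ (ℚ.<⇒≤ (0<½^ a)) (ℚ.<⇒≤ (0<½^ a))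
  weight-guesses a (suc d) = begin
    weight (guess a ++ guesses (suc a) d)               ≡⟨ weight-++ (guess a) (guesses (suc a) d) ⟩
    weight (guess a) ℚ.+ weight (guesses (suc a) d)     ≤⟨ ℚ.+-mono-≤ (weight-guess a) (weight-guesses (suc a) d) ⟩
    ½ ^ a ℚ.+ (½ ^ suc a ℚ.+ ½ ^ suc a)                 ≡⟨ cong (½ ^ a ℚ.+_) (½^-split a) ⟩
    ½ ^ a ℚ.+ ½ ^ a                                     ∎
    where open ℚ.≤-Reasoning

  guess⊆guesses : ∀ a d {n} → a ℕ.≤ n → n ℕ.< a ℕ.+ d → ⟦ guess n ⟧ ⊆ ⟦ guesses a d ⟧
  guess⊆guesses a zero    {n} a≤n n< _  = contradiction a≤n (ℕ.<⇒≱ (subst (n ℕ.<_) (ℕ.+-identityʳ a) n<))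
  guess⊆guesses a (suc d) {n} a≤n n< x∈ with ℕ.m≤n⇒m<n∨m≡n a≤n
  ... | inj₁ a<n  = Any.++⁺ʳ (guess a) (guess⊆guesses (suc a) d a<n (subst (n ℕ.<_) (ℕ.+-suc a d) n<) x∈)
  ... | inj₂ refl = Any.++⁺ˡ x∈

  blockGuesses : ℕ → List Cylinder
  blockGuesses l = guesses (k l) (k (suc l) ∸ k l)

  AlmostGuessed : ℕ → Subset
  AlmostGuessed L x = ∀ l → L ℕ.≤ l → x ∈ ⟦ blockGuesses l ⟧

  -- A single late block is a cover: its weight is at most twice ½ ^ k l, and l ≤ k l.
  AlmostGuessed-compactNull : ∀ L → CompactNull (AlmostGuessed L)
  AlmostGuessed-compactNull L m = blockGuesses l , (begin
    weight (blockGuesses l)      ≤⟨ weight-guesses (k l) (k (suc l) ∸ k l) ⟩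
    ½ ^ k l ℚ.+ ½ ^ k l          ≤⟨ ℚ.+-mono-≤ ½^kl≤ ½^kl≤ ⟩
    ½ ^ suc m ℚ.+ ½ ^ suc m      ≡⟨ ½^-split m ⟩
    ½ ^ m                        ∎) ,
    λ x∈ → x∈ l (ℕ.m≤m⊔n L (suc m))
    where
    open ℚ.≤-Reasoning
    l = L ℕ.⊔ suc m
    ½^kl≤ : ½ ^ k l ℚ.≤ ½ ^ suc m
    ½^kl≤ = ½^-antitone (ℕ.≤-trans (ℕ.m≤n⊔m L (suc m)) (l≤k l))

  AlmostGuessed∈𝓔 : ⋃ ℕ AlmostGuessed ∈ 𝓔
  AlmostGuessed∈𝓔 = union AlmostGuessed (compactNull⇒𝓔 em ∘ AlmostGuessed-compactNull)

  module _ {B : ℕ → Subset} (B-mono : ∀ {j n} → j ℕ.≤ n → B j ⊆ B n)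
    (misses⊆N : ⋃ ℕ (Misses B) ⊆ ⋃ ℕ N) where

    Hit : ℕ → Set
    Hit l = Σ[ n ∈ ℕ ] k l ℕ.≤ n × n ℕ.< k (suc l) × (Σ[ i ∈ ℕ ] Reads t n i × Guesses B n i)

    -- Otherwise copying t on the infinitely many blocks without a hit, and
    -- zeros elsewhere, gives a point of ⋃ Misses that avoids every N j.

    almost-all-hit : Σ[ L ∈ ℕ ] (∀ l → L ℕ.≤ l → Hit l)
    almost-all-hit = dne em λ none → y∉N none (misses⊆N (0 , y-misses))
      where
      InMissedBlock : ℕ → Set
      InMissedBlock i = Σ[ l ∈ ℕ ] ¬ Hit l × k l ℕ.≤ i × i ℕ.< k (suc l)

      y : 2^ω
      y i = if does (em {InMissedBlock i}) then t i else false

      y≡t : ∀ {l} → ¬ Hit l → AgreeOn (k l) (k (suc l)) t y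
      y≡t ¬hit i k≤i i<k rewrite dec-true (em {InMissedBlock i}) (_ , ¬hit , k≤i , i<k) = refl

      y-true : ∀ i → y i ≡ true → InMissedBlock i
      y-true i eq with em {InMissedBlock i}
      ... | yes p = p
      ... | no  _ with () ← eq

      y∉N : ¬ (Σ[ L ∈ ℕ ] (∀ l → L ℕ.≤ l → Hit l)) → y ∉ ⋃ ℕ N
      -- There is a block without a hit whose index is at least j, and y copies t on it.
      y∉N none (j , y∈N) with l , ¬p ← ¬∀⇒∃¬ em (λ h → none (j , h)) =
        avoid l y (y≡t λ hit → ¬p λ _ → hit) j (dne em λ j≰l → ¬p λ j≤l → contradiction j≤l j≰l) y∈N

      y-misses : y ∈ Misses B 0
      -- A correct guess read by y starts with a 1, so it starts in a block without a hit and stays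
      -- there; t reads it too, which is a hit.
      y-misses n _ i (ones , end) g =
        let l , ¬hit , k≤n , n<k = y-true n (subst (λ m → y m ≡ true) (ℕ.+-identityʳ n) (ones 0 z≤n))
            e = ℕ.pred (k (suc l))
            e<k : e ℕ.< k (suc l)
            e<k = ℕ.≤-reflexive (ℕ.suc-pred (k (suc l)) {{ℕ.>-nonZero (ℕ.≤-<-trans z≤n (k< l))}})
            n≤e : n ℕ.≤ e
            n≤e = ℕ.<⇒≤pred n<k
            y-end : y e ≡ false
            y-end = trans (y≡t ¬hit e (ℕ.≤-trans k≤n n≤e) e<k) (t-end l)
            n+i<e : n ℕ.+ i ℕ.< e
            n+i<e = ℕ.≰⇒> λ e≤ → contradiction
              (trans (sym (ones (e ∸ n) (ℕ.m≤n+o⇒m∸n≤o e n e≤))) (trans (cong y (ℕ.m+[n∸m]≡n n≤e)) y-end)) λ ()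
            in-block : ∀ j → j ℕ.≤ suc i → t (n ℕ.+ j) ≡ y (n ℕ.+ j)
            in-block j j≤ = sym (y≡t ¬hit (n ℕ.+ j) (ℕ.≤-trans k≤n (ℕ.m≤m+n n j))
              (ℕ.≤-<-trans (ℕ.≤-trans (ℕ.+-monoʳ-≤ n j≤) (ℕ.≤-trans (ℕ.≤-reflexive (ℕ.+-suc n i)) n+i<e)) e<k))
        in ¬hit (n , k≤n , n<k , i ,
             ((λ j j≤i → trans (in-block j (ℕ.m≤n⇒m≤1+n j≤i)) (ones j j≤i)) , trans (in-block (suc i) ℕ.≤-refl) end) , g)

    ⋃B⊆AlmostGuessed : ⋃ ℕ B ⊆ ⋃ ℕ AlmostGuessed
    -- Beyond L there are hits; beyond j the hit at n satisfies j ≤ l ≤ k l ≤ n, so B j ⊆ B n.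
    ⋃B⊆AlmostGuessed {x} (j , x∈B) = L ℕ.⊔ j , λ l L⊔j≤l →
      let n , k≤n , n<k , i , r , w≤ , B⊆ = hit l (ℕ.≤-trans (ℕ.m≤m⊔n L j) L⊔j≤l)
          j≤n = ℕ.≤-trans (ℕ.≤-trans (ℕ.m≤n⊔m L j) L⊔j≤l) (ℕ.≤-trans (l≤k l) k≤n)
      in guess⊆guesses (k l) (k (suc l) ∸ k l) k≤n
           (subst (n ℕ.<_) (sym (ℕ.m+[n∸m]≡n (ℕ.<⇒≤ (k< l)))) n<k)
           (subst (λ G → x ∈ ⟦ G ⟧) (sym (guess-reads r w≤)) (B⊆ (B-mono j≤n x∈B)))
      where
      L   = proj₁ almost-all-hit
      hit = proj₂ almost-all-hit


module _ (em : ExcludedMiddle 0ℓ) where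

  exhaustion : ∀ {F} → F ∈ 𝓔 → ℕ → Subset
  exhaustion F∈𝓔 = initialUnion (proj₁ (𝓔⇒compactNulls em F∈𝓔))

  missed : ∀ {F} → F ∈ 𝓔 → Subset
  missed F∈𝓔 = ⋃ ℕ (Misses (exhaustion F∈𝓔))

  missed∈𝓜 : ∀ {F} (F∈𝓔 : F ∈ 𝓔) → missed F∈𝓔 ∈ 𝓜
  missed∈𝓜 F∈𝓔 = Misses (exhaustion F∈𝓔) ,
    Misses-nowhereDense (initialUnion-compactNull (proj₁ (proj₂ (𝓔⇒compactNulls em F∈𝓔)))) , id , id

  guessed : ∀ {M} → M ∈ 𝓜 → Subset
  guessed (_ , N-nwd , _) = ⋃ ℕ (AlmostGuessed em (blockAvoidance em N-nwd))

  guessed∈𝓔 : ∀ {M} (M∈𝓜 : M ∈ 𝓜) → guessed M∈𝓜 ∈ 𝓔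
  guessed∈𝓔 (_ , N-nwd , _) = AlmostGuessed∈𝓔 em (blockAvoidance em N-nwd)

  -- Translates are given up to pointwise equality; here membership in each `blockGuesses` set
  -- depends on finitely many bits.
  guessed-resp-≗ : ∀ {M} (M∈𝓜 : M ∈ 𝓜) {x z} → z ≗ x → x ∈ guessed M∈𝓜 → z ∈ guessed M∈𝓜
  guessed-resp-≗ (_ , N-nwd , _) z≗x (L , x∈) = L , λ l L≤l →
    ⟦⟧-determined (blockGuesses em (blockAvoidance em N-nwd) l) (λ i _ → z≗x i) (x∈ l L≤l)

  missed⊆⇒⊆guessed : ∀ {F M} (F∈𝓔 : F ∈ 𝓔) (M∈𝓜 : M ∈ 𝓜) → missed F∈𝓔 ⊆ M → F ⊆ guessed M∈𝓜
  missed⊆⇒⊆guessed F∈𝓔 (_ , N-nwd , M≐⋃N) missed⊆M x∈F =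
    let A , _ , F⊆A = 𝓔⇒compactNulls em F∈𝓔
        j , x∈A = F⊆A x∈F
    in ⋃B⊆AlmostGuessed em (blockAvoidance em N-nwd) (initialUnion-mono A) (proj₁ M≐⋃N ∘ missed⊆M)
         (j , ⊆-initialUnion A j x∈A)

-- From ω^ω to 𝓔

module _ (em : ExcludedMiddle 0ℓ) where

  Compatible : Cylinder → 2^ω → ℕ → Set
  Compatible (y , n) x k = ∀ i → i ℕ.< k → i ℕ.< n → x i ≡ y i

  -- The measure of c inside [ x ↾ k ], relative to that of [ x ↾ k ].

  relMeasure : Cylinder → 2^ω → ℕ → ℚ
  relMeasure c x k with em {Compatible c x k}
  ... | yes _ = ½ ^ (proj₂ c ∸ k)
  ... | no  _ = 0ℚ

  relMeasure-≥0 : ∀ c x k → 0ℚ ℚ.≤ relMeasure c x k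
  relMeasure-≥0 c x k with em {Compatible c x k}
  ... | yes _ = ℚ.<⇒≤ (0<½^ (proj₂ c ∸ k))
  ... | no  _ = ℚ.≤-refl

  relMeasure-yes : ∀ {c x k} → Compatible c x k → relMeasure c x k ≡ ½ ^ (proj₂ c ∸ k)
  relMeasure-yes {c} {x} {k} p with em {Compatible c x k}
  ... | yes _ = refl
  ... | no ¬p = contradiction p ¬p

  Compatible-parent : ∀ {c x k b} → Compatible c (x [ k ≔ b ]) (suc k) → Compatible c x k
  Compatible-parent {x = x} {k} {b} p i i<k i<n =
    trans (sym (≔-below x k b i i<k)) (p i (ℕ.m≤n⇒m≤1+n i<k) i<n)

  Compatible-at : ∀ {c x k b} → k ℕ.< proj₂ c → Compatible c (x [ k ≔ b ]) (suc k) → b ≡ proj₁ c k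
  Compatible-at {x = x} {k} {b} k<n p = trans (sym (≔-at x k b)) (p k ℕ.≤-refl k<n)

  -- If n ≤ k, no child exceeds its parent. If k < n, only the child with bit y k can be compatible,
  -- and then its relative measure is twice that of the parent.
  relMeasure-split : ∀ c x k →
    relMeasure c (x [ k ≔ false ]) (suc k) ℚ.+ relMeasure c (x [ k ≔ true ]) (suc k) ℚ.≤
    relMeasure c x k ℚ.+ relMeasure c x k
  relMeasure-split c@(y , n) x k with n ℕ.≤? k
  ... | yes n≤k = ℚ.+-mono-≤ (child≤ false) (child≤ true)
    where
    child≤ : ∀ b → relMeasure c (x [ k ≔ b ]) (suc k) ℚ.≤ relMeasure c x k
    child≤ b with em {Compatible c (x [ k ≔ b ]) (suc k)}
    ... | no  _ = relMeasure-≥0 c x k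
    ... | yes p = ℚ.≤-reflexive (trans
      (cong (½ ^_) (trans (ℕ.m≤n⇒m∸n≡0 (ℕ.m≤n⇒m≤1+n n≤k)) (sym (ℕ.m≤n⇒m∸n≡0 n≤k))))
      (sym (relMeasure-yes (Compatible-parent {c} p))))
  ... | no  n≰k = bound
    where
    k<n = ℕ.≰⇒> n≰k
    double : ∀ {b} → Compatible c (x [ k ≔ b ]) (suc k) →
             ½ ^ (n ∸ suc k) ≡ relMeasure c x k ℚ.+ relMeasure c x k
    double p = begin
      ½ ^ (n ∸ suc k)                                       ≡⟨ ½^-split (n ∸ suc k) ⟨
      ½ ^ suc (n ∸ suc k) ℚ.+ ½ ^ suc (n ∸ suc k)           ≡⟨ cong (λ m → ½ ^ m ℚ.+ ½ ^ m) (sym (ℕ.+-∸-assoc 1 k<n)) ⟩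
      ½ ^ (n ∸ k) ℚ.+ ½ ^ (n ∸ k)                           ≡⟨ cong₂ ℚ._+_ parent parent ⟨
      relMeasure c x k ℚ.+ relMeasure c x k                 ∎
      where
      open ≡-Reasoning
      parent = relMeasure-yes (Compatible-parent {c} p)
    bound : relMeasure c (x [ k ≔ false ]) (suc k) ℚ.+ relMeasure c (x [ k ≔ true ]) (suc k) ℚ.≤
            relMeasure c x k ℚ.+ relMeasure c x k
    bound with em {Compatible c (x [ k ≔ false ]) (suc k)} | em {Compatible c (x [ k ≔ true ]) (suc k)}
    ... | yes p | yes q with () ← trans (Compatible-at {c} k<n p) (sym (Compatible-at {c} k<n q))
    ... | yes p | no  _ = ℚ.≤-reflexive (trans (ℚ.+-identityʳ _) (double p))
    ... | no  _ | yes q = ℚ.≤-reflexive (trans (ℚ.+-identityˡ _) (double q))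
    ... | no  _ | no  _ = ℚ.+-mono-≤ (relMeasure-≥0 c x k) (relMeasure-≥0 c x k)

  relWeight : List Cylinder → 2^ω → ℕ → ℚ
  relWeight []      x k = 0ℚ
  relWeight (c ∷ L) x k = relMeasure c x k ℚ.+ relWeight L x k

  relWeight-≥0 : ∀ L x k → 0ℚ ℚ.≤ relWeight L x k
  relWeight-≥0 []      x k = ℚ.≤-refl
  relWeight-≥0 (c ∷ L) x k = ℚ.+-mono-≤ (relMeasure-≥0 c x k) (relWeight-≥0 L x k)

  relWeight-split : ∀ L x k →
    relWeight L (x [ k ≔ false ]) (suc k) ℚ.+ relWeight L (x [ k ≔ true ]) (suc k) ℚ.≤
    relWeight L x k ℚ.+ relWeight L x k
  relWeight-split []      x k = ℚ.≤-refl
  relWeight-split (c ∷ L) x k = subst₂ ℚ._≤_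
    (interchange (relMeasure c (x [ k ≔ false ]) (suc k)) (relMeasure c (x [ k ≔ true ]) (suc k))
                 (relWeight L (x [ k ≔ false ]) (suc k)) (relWeight L (x [ k ≔ true ]) (suc k)))
    (interchange (relMeasure c x k) (relMeasure c x k) (relWeight L x k) (relWeight L x k))
    (ℚ.+-mono-≤ (relMeasure-split c x k) (relWeight-split L x k))

  relWeight-child : ∀ L x k b → relWeight L (x [ k ≔ b ]) (suc k) ℚ.≤ relWeight L x k ℚ.+ relWeight L x k
  relWeight-child L x k b = ℚ.≤-trans (summand≤ b) (relWeight-split L x k)
    where
    open ℚ.≤-Reasoning
    w : Bool → ℚ
    w b = relWeight L (x [ k ≔ b ]) (suc k)
    w≥0 : ∀ b → 0ℚ ℚ.≤ w b
    w≥0 b = relWeight-≥0 L (x [ k ≔ b ]) (suc k)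
    summand≤ : ∀ b → w b ℚ.≤ w false ℚ.+ w true
    summand≤ false = begin
      w false               ≡⟨ ℚ.+-identityʳ (w false) ⟨
      w false ℚ.+ 0ℚ        ≤⟨ ℚ.+-monoʳ-≤ (w false) (w≥0 true) ⟩
      w false ℚ.+ w true    ∎
    summand≤ true  = begin
      w true                ≡⟨ ℚ.+-identityˡ (w true) ⟨
      0ℚ ℚ.+ w true         ≤⟨ ℚ.+-monoˡ-≤ (w true) (w≥0 false) ⟩
      w false ℚ.+ w true    ∎

  relWeight-lighter-child : ∀ L x k → Σ[ b ∈ Bool ] relWeight L (x [ k ≔ b ]) (suc k) ℚ.≤ relWeight L x k
  relWeight-lighter-child L x k
    with relWeight L (x [ k ≔ false ]) (suc k) ℚ.≤? relWeight L x k
       | relWeight L (x [ k ≔ true ]) (suc k) ℚ.≤? relWeight L x k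
  ... | yes p | _     = false , p
  ... | no  _ | yes q = true , q
  ... | no ¬p | no ¬q = contradiction
      (ℚ.<-≤-trans (ℚ.+-mono-< (ℚ.≰⇒> ¬p) (ℚ.≰⇒> ¬q)) (relWeight-split L x k)) (ℚ.<-irrefl refl)

  relWeight-root : ∀ L x → relWeight L x 0 ℚ.≤ weight L
  relWeight-root []      x = ℚ.≤-refl
  relWeight-root (c ∷ L) x = ℚ.+-mono-≤ (ℚ.≤-reflexive (relMeasure-yes {c} λ _ ())) (relWeight-root L x)

  -- At a level beyond its depth, a cylinder that contains x fills `[ x ↾ k ]` and contributes 1.
  relWeight-covered : ∀ L {x k} → depth L ℕ.≤ k → x ∈ ⟦ L ⟧ → 1ℚ ℚ.≤ relWeight L x k
  relWeight-covered (c ∷ L) {x} {k} d≤k (here p) = begin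
    1ℚ                                        ≡⟨ cong (½ ^_) (ℕ.m≤n⇒m∸n≡0 (ℕ.m⊔n≤o⇒m≤o (proj₂ c) (depth L) d≤k)) ⟨
    ½ ^ (proj₂ c ∸ k)                         ≡⟨ relMeasure-yes {c} (λ i _ → p i) ⟨
    relMeasure c x k                          ≡⟨ ℚ.+-identityʳ _ ⟨
    relMeasure c x k ℚ.+ 0ℚ                   ≤⟨ ℚ.+-monoʳ-≤ (relMeasure c x k) (relWeight-≥0 L x k) ⟩
    relMeasure c x k ℚ.+ relWeight L x k      ∎
    where open ℚ.≤-Reasoning
  relWeight-covered (c ∷ L) {x} {k} d≤k (there p) = begin
    1ℚ                                        ≤⟨ relWeight-covered L (ℕ.m⊔n≤o⇒n≤o (proj₂ c) (depth L) d≤k) p ⟩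
    relWeight L x k                           ≡⟨ ℚ.+-identityˡ _ ⟨
    0ℚ ℚ.+ relWeight L x k                    ≤⟨ ℚ.+-monoˡ-≤ (relWeight L x k) (relMeasure-≥0 c x k) ⟩
    relMeasure c x k ℚ.+ relWeight L x k      ∎
    where open ℚ.≤-Reasoning

  -- A prescribed bit at most doubles the relative weight, and a free bit can
  -- be chosen so as not to increase it.

  descend : ∀ (D : ℕ → Bool) (a : 2^ω) L r → weight L ℚ.< ½ ^ r → ∀ k → count D k ℕ.≤ r →
    Σ[ x ∈ 2^ω ] (∀ i → i ℕ.< k → D i ≡ true → x i ≡ a i) × relWeight L x k ℚ.< ½ ^ (r ∸ count D k)
  descend D a L r w< zero    _  = const false , (λ _ ()) , ℚ.≤-<-trans (relWeight-root L _) w<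
  descend D a L r w< (suc k) c≤ with D k in Dk
  ... | true  with x , x≡a , w<½^ ← descend D a L r w< k (ℕ.<⇒≤ c≤) =
    x [ k ≔ a k ] ,
    (λ { i (s≤s i≤k) Di → prescribed i Di (ℕ.m≤n⇒m<n∨m≡n i≤k) }) ,
    (begin-strict
      relWeight L (x [ k ≔ a k ]) (suc k)       ≤⟨ relWeight-child L x k (a k) ⟩
      relWeight L x k ℚ.+ relWeight L x k       <⟨ ℚ.+-mono-< w<½^ w<½^ ⟩
      ½ ^ (r ∸ c) ℚ.+ ½ ^ (r ∸ c)               ≡⟨ cong (λ m → ½ ^ m ℚ.+ ½ ^ m) (ℕ.+-∸-assoc 1 c≤) ⟩
      ½ ^ suc (r ∸ suc c) ℚ.+ ½ ^ suc (r ∸ suc c) ≡⟨ ½^-split (r ∸ suc c) ⟩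
      ½ ^ (r ∸ suc c)                           ∎)
    where
    open ℚ.≤-Reasoning
    c = count D k
    prescribed : ∀ i → D i ≡ true → i ℕ.< k ⊎ i ≡ k → (x [ k ≔ a k ]) i ≡ a i
    prescribed i Di (inj₁ i<k)  = trans (≔-below x k (a k) i i<k) (x≡a i i<k Di)
    prescribed i Di (inj₂ refl) = ≔-at x k (a k)
  ... | false with x , x≡a , w<½^ ← descend D a L r w< k c≤
              with b , lighter ← relWeight-lighter-child L x k =
    x [ k ≔ b ] ,
    (λ { i (s≤s i≤k) Di → prescribed i Di (ℕ.m≤n⇒m<n∨m≡n i≤k) }) ,
    ℚ.≤-<-trans lighter w<½^
    where
    prescribed : ∀ i → D i ≡ true → i ℕ.< k ⊎ i ≡ k → (x [ k ≔ b ]) i ≡ a i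
    prescribed i Di (inj₁ i<k)  = trans (≔-below x k b i i<k) (x≡a i i<k Di)
    prescribed i Di (inj₂ refl) with () ← trans (sym Di) Dk

  prescribed-point-outside : ∀ (D : ℕ → Bool) (a : 2^ω) L r → count D (depth L) ℕ.≤ r → weight L ℚ.< ½ ^ r →
    Σ[ x ∈ 2^ω ] (∀ i → D i ≡ true → x i ≡ a i) × x ∉ ⟦ L ⟧
  prescribed-point-outside D a L r c≤ w< with x , x≡a , w<½^ ← descend D a L r w< (depth L) c≤ =
    -- Bits from `depth L` on do not affect membership in `⟦ L ⟧`, so they can be copied from a.
    splice x a (depth L) , prescribed , outside
    where
    prescribed : ∀ i → D i ≡ true → splice x a (depth L) i ≡ a i
    prescribed i Di with i ℕ.<? depth L
    ... | yes i<d = trans (splice-below x a (depth L) i i<d) (x≡a i i<d Di)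
    ... | no  i≮d = splice-above x a (depth L) i (ℕ.≮⇒≥ i≮d)
    outside : splice x a (depth L) ∉ ⟦ L ⟧
    outside p = ℚ.<-irrefl refl (begin-strict
      1ℚ                                ≤⟨ relWeight-covered L ℕ.≤-refl (⟦⟧-determined L (↾-sym (splice-below x a (depth L))) p) ⟩
      relWeight L x (depth L)           <⟨ w<½^ ⟩
      ½ ^ (r ∸ count D (depth L))       ≤⟨ ½^-antitone {0} {r ∸ count D (depth L)} z≤n ⟩
      1ℚ                                ∎)
      where open ℚ.≤-Reasoning

-- f is recorded in the gaps of this set: its j-th element is at least f j.

countAt : (ℕ → ℕ) → ℕ → ℕ
countAt f zero    = 0
countAt f (suc k) = if f (countAt f k) ℕ.≤ᵇ k then suc (countAt f k) else countAt f k

sparse : (ℕ → ℕ) → ℕ → Bool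
sparse f k = f (countAt f k) ℕ.≤ᵇ k

-- `countAt` comes before `sparse` because membership of k depends on the number of elements below
-- k.
count-sparse : ∀ f k → count (sparse f) k ≡ countAt f k
count-sparse f zero    = refl
count-sparse f (suc k) = cong (λ c → if sparse f k then suc c else c) (count-sparse f k)

countAt-bound : ∀ f k {j} → j ℕ.< countAt f k → f j ℕ.< k
countAt-bound f (suc k) {j} j<c with f (countAt f k) ℕ.≤ᵇ k in eq
... | false = ℕ.m≤n⇒m≤1+n (countAt-bound f k j<c)
... | true with ℕ.m≤n⇒m<n∨m≡n (ℕ.s≤s⁻¹ j<c)
...   | inj₁ j<c′ = ℕ.m≤n⇒m≤1+n (countAt-bound f k j<c′)
...   | inj₂ refl = s≤s (ℕ.≤ᵇ⇒≤ (f j) k (Equivalence.from T-≡ eq))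

countAt-suc-≤ : ∀ f k → countAt f k ℕ.≤ countAt f (suc k)
countAt-suc-≤ f k with f (countAt f k) ℕ.≤ᵇ k
... | true  = ℕ.n≤1+n _
... | false = ℕ.≤-refl

countAt-mono : ∀ f d k → countAt f k ℕ.≤ countAt f (d ℕ.+ k)
countAt-mono f zero    k = ℕ.≤-refl
countAt-mono f (suc d) k = ℕ.≤-trans (countAt-mono f d k) (countAt-suc-≤ f (d ℕ.+ k))

countAt-sparse : ∀ f k → f (countAt f k) ℕ.≤ k → countAt f (suc k) ≡ suc (countAt f k)
countAt-sparse f k f≤k rewrite Equivalence.to T-≡ (ℕ.≤⇒≤ᵇ f≤k) = refl

-- If the count is still m at position f m + k, that position enters the set.
countAt-unbounded : ∀ f m → Σ[ k ∈ ℕ ] m ℕ.≤ countAt f k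
countAt-unbounded f zero    = 0 , z≤n
countAt-unbounded f (suc m) with k , m≤c ← countAt-unbounded f m
                            with ℕ.m≤n⇒m<n∨m≡n (ℕ.≤-trans m≤c (countAt-mono f (f m) k))
... | inj₁ m<c = f m ℕ.+ k , m<c
... | inj₂ m≡c = suc (f m ℕ.+ k) , ℕ.≤-reflexive (trans (cong suc m≡c)
  (sym (countAt-sparse f (f m ℕ.+ k) (subst (λ c → f c ℕ.≤ f m ℕ.+ k) m≡c (ℕ.m≤m+n (f m) k)))))

VanishesOn : (ℕ → Bool) → Subset
VanishesOn D x = ∀ i → D i ≡ true → x i ≡ false

vanishesOn-sparse-compactNull : ∀ f → CompactNull (VanishesOn (sparse f))
vanishesOn-sparse-compactNull f m with k , m≤c ← countAt-unbounded f m =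
  cylinders k (prefixes (sparse f) k) ,
  ℚ.≤-trans (ℚ.≤-reflexive (weight-prefixes (sparse f) k))
    (½^-antitone (subst (m ℕ.≤_) (sym (count-sparse f k)) m≤c)) ,
  λ x∈ → Any.map⁺ (prefixes-complete (sparse f) x∈ k)

maxUpTo : (ℕ → ℕ) → ℕ → ℕ
maxUpTo h zero    = h 0
maxUpTo h (suc n) = maxUpTo h n ℕ.⊔ h (suc n)

≤-maxUpTo : ∀ h {i n} → i ℕ.≤ n → h i ℕ.≤ maxUpTo h n
≤-maxUpTo h {n = zero}  z≤n = ℕ.≤-refl
≤-maxUpTo h {n = suc n} i≤  with ℕ.m≤n⇒m<n∨m≡n i≤
... | inj₁ (s≤s i≤n) = ℕ.≤-trans (≤-maxUpTo h i≤n) (ℕ.m≤m⊔n _ _)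
... | inj₂ refl      = ℕ.m≤n⊔m (maxUpTo h n) _

-- Prescribing bits on this set fixes the restriction to m together with the values on D.
below : ℕ → (ℕ → Bool) → ℕ → Bool
below m D i = (i ℕ.<ᵇ m) ∨ D i

count-≤ : ∀ D k → count D k ℕ.≤ k
count-≤ D zero    = z≤n
count-≤ D (suc k) with D k
... | true  = s≤s (count-≤ D k)
... | false = ℕ.m≤n⇒m≤1+n (count-≤ D k)

count-below : ∀ m D k → count (below m D) k ℕ.≤ m ℕ.+ count D k
count-below m D zero    = z≤n
count-below m D (suc k) with k ℕ.<ᵇ m in eq
... | true  = ℕ.≤-trans (s≤s (count-≤ (below m D) k))
                (ℕ.≤-trans (ℕ.<ᵇ⇒< k m (Equivalence.from T-≡ eq)) (ℕ.m≤m+n m _))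
... | false with D k
...   | true  = subst (suc (count (below m D) k) ℕ.≤_) (sym (ℕ.+-suc m (count D k))) (s≤s (count-below m D k))
...   | false = count-below m D k

module _ (em : ExcludedMiddle 0ℓ) where

  module _ {A : ℕ → Subset} (A-null : ∀ n → CompactNull (A n)) where

    cover : ℕ → ℕ → List Cylinder
    cover n m = proj₁ (A-null n m)

    -- The maximum ranges over all covers `cover l (suc (m + j))` with l, m ≤ j, those that
    -- `avoidStep` may use.
    coverDepth : ℕ → ℕ
    coverDepth j = maxUpTo (λ n → maxUpTo (λ m → depth (cover n m)) (suc (j ℕ.+ j))) j

    module _ (f : ℕ → ℕ) (z : 2^ω) (f≰* : ¬ (f ≤* coverDepth)) where

      Follows : 2^ω → Set
      Follows x = ∀ i → sparse f i ≡ true → x i ≡ z i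

      large : ∀ m → Σ[ j ∈ ℕ ] m ℕ.≤ j × coverDepth j ℕ.< f j
      large m with j , ¬p ← ¬∀⇒∃¬ em (λ h → f≰* (m , h)) =
        j , dne em (λ m≰j → ¬p λ m≤j → contradiction m≤j m≰j) ,
        ℕ.≰⇒> (λ f≤ → ¬p λ _ → f≤)

      -- As `coverDepth j` < f j, at most j elements of the sparse set lie below the depth of the
      -- cover. With the first m bits this prescribes at most m + j bits there, too few for a cover
      -- of weight below ½ ^ (m + j) to catch every such point.
      avoidStep : ∀ l x m → Follows x →
        Σ[ y ∈ 2^ω ] Σ[ k ∈ ℕ ] m ℕ.< k × [ x ↾ m ] y × Follows y × (∀ w → [ y ↾ k ] w → w ∉ A l)
      avoidStep l x m x-follows =
        let j , l⊔m≤j , g<f = large (l ℕ.⊔ m)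
            l≤j = ℕ.≤-trans (ℕ.m≤m⊔n l m) l⊔m≤j
            m≤j = ℕ.≤-trans (ℕ.m≤n⊔m l m) l⊔m≤j
            -- The additional halving makes the weight bound strict.
            L = cover l (suc (m ℕ.+ j))
            d≤g : depth L ℕ.≤ coverDepth j
            d≤g = ℕ.≤-trans (≤-maxUpTo (λ i → depth (cover l i)) (s≤s (ℕ.+-monoˡ-≤ j m≤j)))
                    (≤-maxUpTo (λ n → maxUpTo (λ i → depth (cover n i)) (suc (j ℕ.+ j))) l≤j)
            c≤j : count (sparse f) (depth L) ℕ.≤ j
            c≤j = subst (ℕ._≤ j) (sym (count-sparse f (depth L))) (ℕ.≮⇒≥ λ j<c →
                    ℕ.<-asym g<f (ℕ.<-≤-trans (countAt-bound f (depth L) j<c) d≤g))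
            _ , wL , A⊆L = A-null l (suc (m ℕ.+ j))
            y , y≡x , y∉L = prescribed-point-outside em (below m (sparse f)) x L (m ℕ.+ j)
              (ℕ.≤-trans (count-below m (sparse f) (depth L)) (ℕ.+-monoʳ-≤ m c≤j))
              (ℚ.≤-<-trans wL (½^-suc-< (m ℕ.+ j)))
        in y , suc m ℕ.⊔ depth L , ℕ.m≤m⊔n (suc m) (depth L) ,
           (λ i i<m → y≡x i (cong (_∨ sparse f i) (Equivalence.to T-≡ (ℕ.<⇒<ᵇ i<m)))) ,
           (λ i Di → trans (y≡x i (trans (cong ((i ℕ.<ᵇ m) ∨_) Di) (∨-zeroʳ _))) (x-follows i Di)) ,
           λ w w∈ w∈A → y∉L (⟦⟧-determined L (↾-≤ (ℕ.m≤n⊔m (suc m) (depth L)) (↾-sym w∈)) (A⊆L w∈A))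

      -- All w ≗ x are treated because a subset need not respect pointwise equality. Bit i of the
      -- limit is bit i of stage i + 1, which follows z.
      follower-outside : Σ[ x ∈ 2^ω ] Follows x × (∀ w → w ≗ x → w ∉ ⋃ ℕ A)
      follower-outside = limit , (λ i → proj₂ (proj₂ (stage (suc i))) i) ,
        λ w w≗ (l , w∈A) → let x , m , x-follows = stage l
                               _ , _ , _ , _ , _ , avoids = avoidStep l x m x-follows
                           in avoids w (λ i i<k → trans (w≗ i) (limit-↾ (suc l) i i<k)) w∈A
        where
        State : Set
        State = Σ[ x ∈ 2^ω ] ℕ × Follows x

        next : ℕ → State → State
        next l (x , m , x-follows) = let y , k , _ , _ , y-follows , _ = avoidStep l x m x-follows
                                     in y , k , y-follows

        open Fusion {S = State} proj₁ (proj₁ ∘ proj₂) next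
          (λ l (x , m , fo) → proj₁ (proj₂ (proj₂ (avoidStep l x m fo))))
          (λ l (x , m , fo) → proj₁ (proj₂ (proj₂ (proj₂ (avoidStep l x m fo)))))
          (z , 0 , λ _ _ → refl)

  sparseSet∈𝓔 : ∀ f → VanishesOn (sparse f) ∈ 𝓔
  sparseSet∈𝓔 f = compactNull⇒𝓔 em (vanishesOn-sparse-compactNull f)

  bound : ∀ {X} → X ∈ 𝓔 → ℕ → ℕ
  bound X∈𝓔 = coverDepth (proj₁ (proj₂ (𝓔⇒compactNulls em X∈𝓔)))

  -- The hypothesis puts the translate by z of `VanishesOn (sparse f)` into X, up to pointwise
  -- equality; this weak form suits both the 𝔟 and the 𝔡 inequality.
  ≤*-bound : ∀ {X} (X∈𝓔 : X ∈ 𝓔) f z →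
    (∀ x → (∀ i → sparse f i ≡ true → x i ≡ z i) → Σ[ w ∈ 2^ω ] w ≗ x × w ∈ X) → f ≤* bound X∈𝓔
  ≤*-bound X∈𝓔 f z h = dne em λ f≰* →
    let A , A-null , X⊆A = 𝓔⇒compactNulls em X∈𝓔
        x , x-follows , outside = follower-outside A-null f z f≰*
        w , w≗x , w∈X = h x x-follows
    in outside w w≗x (X⊆A w∈X)

-- Cardinals

module _ {a} (S : Setoid a 0ℓ) where

  open Setoid S using (Carrier; _≈_) renaming (sym to ≈-sym; trans to ≈-trans; reflexive to ≈-reflexive)

  image : {K : Set} → (K → Carrier) → Family S
  image {K} g s = Σ[ k ∈ K ] s ≈ g k

  module _ {p : Level} {P : Pred (Family S) p} {κ : Set} (min : IsMinCard S P κ) where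

    open IsMinCard min

    -- The indexing g may repeat sets: membership in the image carries an index, and members with
    -- equal indices are equal, so taking indices keeps `least` injective.
    minCard-↣ : ∀ {K} (g : K → Carrier) → P (image g) → κ ↣ K
    minCard-↣ {K} g Pg = mk↣ {to = index} λ {i} {j} eq →
      injective (≈-trans (proj₂ (proj₂ (to i)))
        (≈-trans (≈-reflexive (cong g eq)) (≈-sym (proj₂ (proj₂ (to j))))))
      where
      open Injection (least (image g) Pg) using (to; injective)
      index : κ → K
      index i = proj₁ (proj₂ (to i))

    minFamily : Family S
    minFamily = proj₁ attained

    minFamily-P : P minFamily
    minFamily-P = proj₁ (proj₂ attained)

    enumerate : κ → Σ[ s ∈ Carrier ] s ∈ minFamily
    enumerate = Bijection.to (proj₂ (proj₂ attained))

    enumerate-surjective : ∀ {s} → s ∈ minFamily → Σ[ k ∈ κ ] proj₁ (enumerate k) ≈ s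
    enumerate-surjective {s} s∈ = Bijection.strictlySurjective (proj₂ (proj₂ attained)) (s , s∈)

⊕-cancelʳ : ∀ x z → (x ⊕ z) ⊕ z ≗ x
⊕-cancelʳ x z i = trans (xor-assoc (x i) (z i) (z i))
  (trans (cong (x i xor_) (xor-same (z i))) (xor-identityʳ (x i)))

≡⇒xor≡false : ∀ {b c} → b ≡ c → b xor c ≡ false
≡⇒xor≡false {b} refl = xor-same b

𝓜-resp-≐ : ∀ {X Y} → X ≐ Y → Y ∈ 𝓜 → X ∈ 𝓜
𝓜-resp-≐ (X⊆Y , Y⊆X) (N , N-nwd , Y⊆N , N⊆Y) = N , N-nwd , (λ x → Y⊆N (X⊆Y x)) , λ x → Y⊆X (N⊆Y x)

-- The four inequalities

module _ (em : ExcludedMiddle 0ℓ) where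

  add𝓜≤add*ₜ𝓔 : ∀ {κ λ′} → Is-add 𝓜 κ → Is-add*ₜ 𝓔 λ′ → κ ↣ λ′
  add𝓜≤add*ₜ𝓔 {λ′ = K} add𝓜 add*ₜ𝓔 = minCard-↣ 𝒫[2^ω] add𝓜 G (G⊆𝓜 , U , U-union , U∉𝓜)
    where
    𝓕⊆𝓔 = proj₁ (minFamily-P 𝒫[2^ω] add*ₜ𝓔)
    F : K → Subset
    F k = proj₁ (enumerate 𝒫[2^ω] add*ₜ𝓔 k)
    F∈𝓔 : ∀ k → F k ∈ 𝓔
    F∈𝓔 k = 𝓕⊆𝓔 (proj₂ (enumerate 𝒫[2^ω] add*ₜ𝓔 k))
    G : K → Subset
    G k = missed em (F∈𝓔 k)
    G⊆𝓜 : image 𝒫[2^ω] G ⊆ 𝓜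
    G⊆𝓜 (k , A≐) = 𝓜-resp-≐ A≐ (missed∈𝓜 em (F∈𝓔 k))
    U : Subset
    U = ⋃ K G
    U-union : U IsUnionOf image 𝒫[2^ω] G
    U-union x = mk⇔ (λ (k , x∈) → G k , (k , id , id) , x∈) (λ (_ , (k , A⊆ , _) , x∈) → k , A⊆ x∈)
    U∉𝓜 : U ∉ 𝓜
    U∉𝓜 U∈𝓜 = proj₂ (minFamily-P 𝒫[2^ω] add*ₜ𝓔)
      -- One set in 𝓔 includes every member of the family, so the zero translation serves for all.
      (guessed em U∈𝓜 , guessed∈𝓔 em U∈𝓜 , λ A A∈𝓕 → const false , λ (y , y∈A , z≗y) →
        let k , _ , A⊆Fk = enumerate-surjective 𝒫[2^ω] add*ₜ𝓔 A∈𝓕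
        in guessed-resp-≗ em U∈𝓜 (λ i → trans (z≗y i) (xor-identityʳ (y i)))
             (missed⊆⇒⊆guessed em (F∈𝓔 k) U∈𝓜 (λ x∈ → k , x∈) (A⊆Fk y∈A)))

  add*ₜ𝓔≤𝔟 : ∀ {κ λ′} → Is-add*ₜ 𝓔 κ → Is-𝔟 λ′ → κ ↣ λ′
  add*ₜ𝓔≤𝔟 {λ′ = K} add*ₜ𝓔 𝔟 = minCard-↣ 𝒫[2^ω] add*ₜ𝓔 G
    ( (λ (k , A⊆ , _) → subset A⊆ (sparseSet∈𝓔 em (f k)))
    , λ (X , X∈𝓔 , translates) → minFamily-P ω^ω 𝔟 (bound em X∈𝓔 , λ h h∈ →
        let k , fk≗h = enumerate-surjective ω^ω 𝔟 h∈
            z , G+z⊆X = translates (G k) (k , id , id)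
            m , fk≤ = ≤*-bound em X∈𝓔 (f k) z λ x x-follows → x , (λ _ → refl) ,
              G+z⊆X (x ⊕ z , (λ i Di → ≡⇒xor≡false (x-follows i Di)) , λ i → sym (⊕-cancelʳ x z i))
        in m , λ n m≤n → subst (ℕ._≤ bound em X∈𝓔 n) (fk≗h n) (fk≤ n m≤n)) )
    where
    f : K → ℕ → ℕ
    f k = proj₁ (enumerate ω^ω 𝔟 k)
    G : K → Subset
    G k = VanishesOn (sparse (f k))

  𝔡≤cof*ₜ𝓔 : ∀ {κ λ′} → Is-𝔡 κ → Is-cof*ₜ 𝓔 λ′ → κ ↣ λ′
  𝔡≤cof*ₜ𝓔 {λ′ = K} 𝔡 cof*ₜ𝓔 = minCard-↣ ω^ω 𝔡 g λ f →
    let Y , Y∈𝓕 , z , Vf⊆Y+z = cofinal (VanishesOn (sparse f)) (sparseSet∈𝓔 em f)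
        k , _ , Y⊆Fk = enumerate-surjective 𝒫[2^ω] cof*ₜ𝓔 Y∈𝓕
    in g k , (k , λ _ → refl) , ≤*-bound em (F∈𝓔 k) f z λ x x-follows →
         -- Since x equals z on the sparse set, x ⊕ z vanishes there; cancelling z then gives y ≗ x.
         let y , y∈Y , x⊕z≗y⊕z = Vf⊆Y+z {x ⊕ z} (λ i Di → ≡⇒xor≡false (x-follows i Di))
         in y , (λ i → trans (sym (⊕-cancelʳ y z i)) (trans (cong (_xor z i) (sym (x⊕z≗y⊕z i))) (⊕-cancelʳ x z i)))
              , Y⊆Fk y∈Y
    where
    𝓕⊆𝓔     = proj₁ (minFamily-P 𝒫[2^ω] cof*ₜ𝓔)
    cofinal = proj₂ (minFamily-P 𝒫[2^ω] cof*ₜ𝓔)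
    F∈𝓔 : ∀ k → proj₁ (enumerate 𝒫[2^ω] cof*ₜ𝓔 k) ∈ 𝓔
    F∈𝓔 k = 𝓕⊆𝓔 (proj₂ (enumerate 𝒫[2^ω] cof*ₜ𝓔 k))
    g : K → ℕ → ℕ
    g k = bound em (F∈𝓔 k)

  cof*ₜ𝓔≤cof𝓜 : ∀ {κ λ′} → Is-cof*ₜ 𝓔 κ → Is-cof 𝓜 λ′ → κ ↣ λ′
  cof*ₜ𝓔≤cof𝓜 {λ′ = K} cof*ₜ𝓔 cof𝓜 = minCard-↣ 𝒫[2^ω] cof*ₜ𝓔 G
    ( (λ (k , A⊆ , _) → subset A⊆ (guessed∈𝓔 em (F∈𝓜 k)))
    , λ Y Y∈𝓔 →
        let M , M∈𝓕 , missed⊆M = cofinal (missed em Y∈𝓔) (missed∈𝓜 em Y∈𝓔)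
            k , _ , M⊆Fk = enumerate-surjective 𝒫[2^ω] cof𝓜 M∈𝓕
        in G k , (k , id , id) , const false , λ {x} x∈Y →
             x , missed⊆⇒⊆guessed em Y∈𝓔 (F∈𝓜 k) (λ y∈ → M⊆Fk (missed⊆M y∈)) x∈Y , λ i → sym (xor-identityʳ (x i)) )
    where
    𝓕⊆𝓜     = proj₁ (minFamily-P 𝒫[2^ω] cof𝓜)
    cofinal = proj₂ (minFamily-P 𝒫[2^ω] cof𝓜)
    F∈𝓜 : ∀ k → proj₁ (enumerate 𝒫[2^ω] cof𝓜 k) ∈ 𝓜
    F∈𝓜 k = 𝓕⊆𝓜 (proj₂ (enumerate 𝒫[2^ω] cof𝓜 k))
    G : K → Subset
    G k = guessed em (F∈𝓜 k)

theorem4p13 : Classical →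
    ({add[𝓜] add*ₜ[𝓔] 𝔟 : Set} →
    Is-add 𝓜 add[𝓜] → Is-add*ₜ 𝓔 add*ₜ[𝓔] → Is-𝔟 𝔟 →
    (add[𝓜] ↣ add*ₜ[𝓔]) × (add*ₜ[𝓔] ↣ 𝔟))
    ×
    ({𝔡 cof*ₜ[𝓔] cof[𝓜] : Set} →
    Is-𝔡 𝔡 → Is-cof*ₜ 𝓔 cof*ₜ[𝓔] → Is-cof 𝓜 cof[𝓜] →
    (𝔡 ↣ cof*ₜ[𝓔]) × (cof*ₜ[𝓔] ↣ cof[𝓜]))
theorem4p13 em =
  (λ add𝓜 add*ₜ𝓔 𝔟 → add𝓜≤add*ₜ𝓔 em add𝓜 add*ₜ𝓔 , add*ₜ𝓔≤𝔟 em add*ₜ𝓔 𝔟) ,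
  (λ 𝔡 cof*ₜ𝓔 cof𝓜 → 𝔡≤cof*ₜ𝓔 em 𝔡 cof*ₜ𝓔 , cof*ₜ𝓔≤cof𝓜 em cof*ₜ𝓔 cof𝓜)
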